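{- Let $T$ be a tree with maximum degree $\Delta(T)$. If $\varphi$ is an edge precoloring of $\Delta(T)$ edges of $T \square K_2$ using colors from $\{1,\dots,\Delta(T)+1\}$, then $\varphi$ can be extended to a proper $(\Delta(T)+1)$-edge coloring of $T \square K_2$.
   Context: $G \square H$ denotes the cartesian product of graphs $G$ and $H$. An edge precoloring (partial edge coloring) of a graph is a proper edge coloring of some subset of its edges (adjacent precolored edges receive distinct colors). A precoloring $\varphi$ is extended by a proper $t$-edge coloring $f$ (colors $\{1,\dots,t\}$) if $f(e)=\varphi(e)$ for every edge $e$ colored under $\varphi$. -}

module Defs where

open import Data.Nat using (ℕ; zero; suc; _≤_; _⊔_)
open import Data.Bool using (Bool; true; false)
open import Data.Fin using (Fin)
open import Data.List using (List; []; _∷_; _++_; length; filterᵇ; allFin; map; foldr)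
open import Data.List.Relation.Unary.Linked using (Linked)
open import Data.List.Relation.Unary.Unique.Propositional using (Unique)
open import Data.List.Relation.Unary.All using (All)
open import Data.List.Relation.Unary.AllPairs using (AllPairs)
open import Data.Product using (Σ; _×_; _,_)
open import Data.Sum using (_⊎_)
open import Relation.Binary.PropositionalEquality using (_≡_; _≢_)
open import Relation.Nullary using (¬_)

record SimpleGraph (n : ℕ) : Set where
  field
    adj    : Fin n → Fin n → Bool
    sym    : ∀ u v → adj u v ≡ adj v u
    irrefl : ∀ v → adj v v ≡ false

module _ {n : ℕ} (G : SimpleGraph n) where
  open SimpleGraph G

  Adj : Fin n → Fin n → Set
  Adj u v = adj u v ≡ true

  degree : Fin n → ℕ
  degree v = length (filterᵇ (adj v) (allFin n))

  maxDegree : ℕ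
  maxDegree = foldr _⊔_ 0 (map degree (allFin n))

  data Reach : Fin n → Fin n → Set where
    here : ∀ {u} → Reach u u
    step : ∀ {u w v} → Adj u w → Reach w v → Reach u v

  Connected : Set
  Connected = ∀ u v → Reach u v

  Cycle : Set
  Cycle = Σ (Fin n) λ a → Σ (Fin n) λ b → Σ (List (Fin n)) λ rest → Σ (Fin n) λ z →
            Unique (a ∷ b ∷ rest ++ z ∷ []) × Linked Adj (a ∷ b ∷ rest ++ z ∷ []) × Adj z a

  Acyclic : Set
  Acyclic = ¬ Cycle

  IsTree : Set
  IsTree = 1 ≤ n × Connected × Acyclic

K₂Adj : Bool → Bool → Set
K₂Adj i j = i ≢ j

□K₂Adj : {n : ℕ} → SimpleGraph n → (Fin n × Bool) → (Fin n × Bool) → Set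
□K₂Adj G (u , i) (v , j) = (Adj G u v × i ≡ j) ⊎ (u ≡ v × K₂Adj i j)

module _ {V : Set} (E : V → V → Set) where

  ProperEdgeColouring : ℕ → (V → V → ℕ) → Set
  ProperEdgeColouring t f =
      (∀ u v → E u v → f u v ≡ f v u)
    × (∀ u v → E u v → 1 ≤ f u v × f u v ≤ t)
    × (∀ u v w → E u v → E u w → v ≢ w → f u v ≢ f u w)

  PreEdge : Set
  PreEdge = V × V × ℕ

  SameEdge : PreEdge → PreEdge → Set
  SameEdge (u , v , _) (u' , v' , _) = (u ≡ u' × v ≡ v') ⊎ (u ≡ v' × v ≡ u')

  ShareEnd : PreEdge → PreEdge → Set
  ShareEnd (u , v , _) (u' , v' , _) = u ≡ u' ⊎ u ≡ v' ⊎ v ≡ u' ⊎ v ≡ v'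

  colourOf : PreEdge → ℕ
  colourOf (_ , _ , c) = c

  Compatible : PreEdge → PreEdge → Set
  Compatible e e' = ¬ SameEdge e e' × (ShareEnd e e' → colourOf e ≢ colourOf e')

  IsPrecolouring : ℕ → List PreEdge → Set
  IsPrecolouring t φ =
      All (λ { (u , v , c) → E u v × 1 ≤ c × c ≤ t }) φ
    × AllPairs Compatible φ

  Extends : (V → V → ℕ) → List PreEdge → Set
  Extends f φ = All (λ { (u , v , c) → f u v ≡ c }) φ

{-# OPTIONS --safe #-}
module Submission where

-- Let D = Δ(T) ≥ 2 and root T.  A branch whose parent edge has its two copies coloured a and b extends
-- whenever D is at least its number of precoloured edges plus 1 (if a = b) or plus 2 (if a ≠ b).  This is
-- shown by induction: at a vertex one colours first the rung and then, independently in the two copies, the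
-- edges to the children, avoiding the colours precoloured at the children.  A child whose branch has D - 1
-- precoloured edges gets the same colour in both copies; a child whose branch carries all precoloured
-- edges is coloured before its parent.  For D ≤ 1 one colour for the rungs and one for the rest suffice.

open import Defs
open import Data.Nat using (ℕ; zero; suc; _+_; _∸_; _⊔_; _≤_; _<_; z≤n; s≤s; _≤?_)
open import Data.Nat.DivMod using (_mod_; m<n⇒m%n≡m)
open import Data.Nat.Properties hiding (_≟_)
open import Algebra.Properties.CommutativeSemigroup +-commutativeSemigroup using (interchange)
open import Data.Bool using (Bool; true; false; T)
import Data.Bool.Properties as Bool
open import Data.Fin using (Fin; toℕ)
open import Data.Fin.Properties using (_≟_; ¬∀⟶∃¬; toℕ-fromℕ<; toℕ<n; toℕ-injective)
open import Data.List using (List; []; _∷_; [_]; _++_; length; map; filter; concatMap; catMaybes; allFin; foldr; fromMaybe; cartesianProduct)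
open import Data.List.Properties using (length-map; length-tabulate; length-++; filter-none; filter-++; catMaybes-++; map-++; map-∘)
open import Data.List.Membership.Propositional using (_∈_; _∉_; find)
open import Data.List.Membership.Propositional.Properties
open import Data.List.Relation.Unary.Any using (here; there)
open import Data.List.Relation.Unary.All as All using (All; []; _∷_)
import Data.List.Relation.Unary.All.Properties as All
open import Data.List.Relation.Unary.AllPairs as AllPairs using (AllPairs; []; _∷_)
import Data.List.Relation.Unary.AllPairs.Properties as AllPairs
open import Data.List.Relation.Unary.Linked using (Linked; [-]; _∷_)
open import Data.List.Relation.Unary.Unique.Propositional using (Unique)
open import Data.List.Relation.Unary.Unique.Propositional.Properties using (allFin⁺; cartesianProduct⁺)
open import Data.List.Relation.Binary.Permutation.Propositional using (_↭_; ↭-refl; ↭-sym; ↭-trans; ↭-reflexive; ↭-prep; ↭-swap; ↭⇒↭ₛ)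
open import Data.List.Relation.Binary.Permutation.Propositional.Properties using (map⁺; ++⁺ʳ; ++⁺ˡ; shift; ∈-resp-↭)
import Data.List.Relation.Binary.Permutation.Setoid.Properties as Permutation
open import Data.List.Relation.Binary.Pointwise as Pointwise using (Pointwise; []; _∷_)
open import Data.List.Relation.Binary.Sublist.Propositional as Sublist using (_⊆_; []; _∷_; _∷ʳ_; ⊆-refl; ⊆-trans)
import Data.List.Relation.Binary.Sublist.Propositional.Properties as Sublist
import Data.Maybe as Maybe
open import Data.Maybe using (Maybe; just; nothing)
import Data.Maybe.Properties as Maybe
open import Data.Maybe.Properties using (just-injective)
open import Data.Product using (Σ; ∃; _×_; _,_; proj₁; proj₂; swap)
import Data.Product.Properties as Product
open import Data.Sum using (_⊎_; inj₁; inj₂; [_,_]′)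
open import Function using (_∘_; id; case_of_)
open import Relation.Binary.Definitions using (DecidableEquality)
open import Relation.Binary.PropositionalEquality using (_≡_; _≢_; refl; sym; trans; cong; cong₂; subst; setoid; module ≡-Reasoning)
open import Relation.Nullary using (¬_; yes; no; ¬?; contradiction)
open import Relation.Nullary.Decidable.Core using (T?)

-- The star of a vertex is coloured by a Hall-type count: a precoloured edge of a child's branch
-- takes at most one of the `suc D` colours at the vertex or forbids at most one on an edge to that
-- child, so the obstructions number at most `D`, one less than the colours. The two copies of a
-- star meet only in the rung; the delicate point is one rung colour that leaves room in both,
-- although the precolours may be spread unevenly over them. The descent has to be paid for as well:
-- the pair of colours above a child becomes a prescription for its branch and consumes one unit of
-- the budget `D` if monochromatic, two otherwise. A branch with `D - 1` precoloured edges can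
-- afford only the former. A branch holding the whole budget may afford no imposed colour, but then
-- the rest of the star is free and can adapt to the pair that the branch produces. For this reason
-- the induction hypothesis `Solvable` admits partial prescriptions. The pair so produced may have
-- two colours, which is where `2 ≤ D` enters.

module _ {A : Set} where

  unique-⊆⇒length≤ : {xs ys : List A} → Unique xs → (∀ {x} → x ∈ xs → x ∈ ys) → length xs ≤ length ys
  unique-⊆⇒length≤ [] _ = z≤n
  unique-⊆⇒length≤ {x ∷ xs} (x∉xs ∷ u) xs⊆ys with as , bs , refl ← ∈-∃++ (xs⊆ys (here refl)) = begin
    suc (length xs)         ≤⟨ s≤s (unique-⊆⇒length≤ u rest) ⟩
    suc (length (as ++ bs)) ≡⟨ cong suc (length-++ as) ⟩
    suc (length as + length bs) ≡⟨ +-suc (length as) (length bs) ⟨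
    length as + suc (length bs) ≡⟨ length-++ as ⟨
    length (as ++ x ∷ bs) ∎
    where
    open ≤-Reasoning
    rest : ∀ {y} → y ∈ xs → y ∈ as ++ bs
    rest y∈xs with ∈-++⁻ as (xs⊆ys (there y∈xs))
    ... | inj₁ y∈as = ∈-++⁺ˡ y∈as
    ... | inj₂ (here refl) = contradiction refl (All.lookup x∉xs y∈xs)
    ... | inj₂ (there y∈bs) = ∈-++⁺ʳ as y∈bs

  ⊆-missing⇒length< : {xs ys : List A} {x : A} → xs ⊆ ys → x ∈ ys → x ∉ xs → length xs < length ys
  ⊆-missing⇒length< (_ ∷ʳ s) _ _ = s≤s (Sublist.length-mono-≤ s)
  ⊆-missing⇒length< (refl ∷ s) (here refl) x∉ = contradiction (here refl) x∉
  ⊆-missing⇒length< (refl ∷ s) (there x∈) x∉ = s≤s (⊆-missing⇒length< s x∈ (x∉ ∘ there))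

  ∈-fromMaybe : ∀ {m : Maybe A} {c} → m ≡ just c → c ∈ fromMaybe m
  ∈-fromMaybe refl = here refl

  ∈-fromMaybe⁻ : ∀ {m : Maybe A} {c} → c ∈ fromMaybe m → m ≡ just c
  ∈-fromMaybe⁻ {m = just _} (here refl) = refl

  ∈-catMaybes⁻ : ∀ {ms : List (Maybe A)} {c} → c ∈ catMaybes ms → just c ∈ ms
  ∈-catMaybes⁻ {ms = just _ ∷ _}  (here refl) = here refl
  ∈-catMaybes⁻ {ms = just _ ∷ _}  (there c∈)  = there (∈-catMaybes⁻ c∈)
  ∈-catMaybes⁻ {ms = nothing ∷ _} c∈          = there (∈-catMaybes⁻ c∈)

  ∈-catMaybes⁺ : ∀ {ms : List (Maybe A)} {c} → just c ∈ ms → c ∈ catMaybes ms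
  ∈-catMaybes⁺ {ms = just _ ∷ _}  (here refl) = here refl
  ∈-catMaybes⁺ {ms = just _ ∷ _}  (there c∈)  = there (∈-catMaybes⁺ c∈)
  ∈-catMaybes⁺ {ms = nothing ∷ _} (there c∈)  = ∈-catMaybes⁺ c∈

  length-catMaybes-∷ : ∀ (m : Maybe A) ms → length (catMaybes (m ∷ ms)) ≡ length (fromMaybe m) + length (catMaybes ms)
  length-catMaybes-∷ nothing  _ = refl
  length-catMaybes-∷ (just _) _ = refl

  frees : List (Maybe A) → ℕ
  frees []             = 0
  frees (just _ ∷ ms)  = frees ms
  frees (nothing ∷ ms) = suc (frees ms)

  length-catMaybes+frees : ∀ ms → length (catMaybes ms) + frees ms ≡ length ms
  length-catMaybes+frees []             = refl
  length-catMaybes+frees (just _ ∷ ms)  = cong suc (length-catMaybes+frees ms)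
  length-catMaybes+frees (nothing ∷ ms) = trans (+-suc (length (catMaybes ms)) _) (cong suc (length-catMaybes+frees ms))

module _ {A B : Set} where

  zip-pointwise : {R₀ R₁ : A → B → Set} → ∀ {xs ys zs} → Pointwise R₀ xs ys → Pointwise R₁ xs zs →
    ∃ λ ps → Pointwise (λ x p → R₀ x (proj₁ p) × R₁ x (proj₂ p)) xs ps × map proj₁ ps ≡ ys × map proj₂ ps ≡ zs
  zip-pointwise [] [] = [] , [] , refl , refl
  zip-pointwise {ys = y ∷ _} {zs = z ∷ _} (r ∷ rs) (s ∷ ss) =
    let ps , pw , e , e′ = zip-pointwise rs ss in
    (y , z) ∷ ps , (r , s) ∷ pw , cong (y ∷_) e , cong (z ∷_) e′

  pointwise-++⁻ : ∀ {R : A → B → Set} xs {ys zs} → Pointwise R (xs ++ ys) zs →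
    ∃ λ as → ∃ λ bs → zs ≡ as ++ bs × Pointwise R xs as × Pointwise R ys bs
  pointwise-++⁻ [] rs = [] , _ , refl , [] , rs
  pointwise-++⁻ (x ∷ xs) {zs = z ∷ _} (r ∷ rs) =
    let as , bs , e , ps , qs = pointwise-++⁻ xs rs in z ∷ as , bs , cong (z ∷_) e , r ∷ ps , qs

-- Colouring the star of one vertex in both copies.

at : {A : Set} → Bool → A × A → A
at false = proj₁
at true  = proj₂

Apart : {A : Set} → Maybe A → Maybe A → Set
Apart m m′ = ∀ c → m ≡ just c → m′ ≢ just c

module Palette (D : ℕ) where

  Colour : Set
  Colour = Fin (suc D)

  open import Data.List.Membership.DecPropositional (_≟_ {suc D}) using (_∈?_) public

  fresh : (U : List Colour) → length U ≤ D → ∃ λ c → c ∉ U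
  fresh U short = ¬∀⟶∃¬ (suc D) (_∈ U) (_∈? U) λ all → <-irrefl refl (begin-strict
    length U                  <⟨ s≤s short ⟩
    suc D                     ≡⟨ length-tabulate id ⟨
    length (allFin (suc D))   ≤⟨ unique-⊆⇒length≤ (allFin⁺ (suc D)) (λ {c} _ → all c) ⟩
    length U ∎)
    where open ≤-Reasoning

  -- Repetitions survive: a colour forbidden on two edges is two incidences.
  out : List Colour → List Colour → List Colour
  out U = filter (λ c → ¬? (c ∈? U))

  out-[]⇒⊆ : ∀ {U} F → out U F ≡ [] → ∀ {c} → c ∈ F → c ∈ U
  out-[]⇒⊆ {U} F e {c} c∈F with c ∈? U
  ... | yes c∈U = c∈U
  ... | no c∉U = case subst (c ∈_) e (∈-filter⁺ (λ c → ¬? (c ∈? U)) c∈F c∉U) of λ ()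

  ⊆⇒out-[] : ∀ {U} F → (∀ {c} → c ∈ F → c ∈ U) → out U F ≡ []
  ⊆⇒out-[] {U} F F⊆U = filter-none (λ c → ¬? (c ∈? U)) {F} (All.tabulate λ c∈F c∉U → c∉U (F⊆U c∈F))

  out-mono : ∀ {U V F G} → (∀ {c} → c ∈ U → c ∈ V) → F ⊆ G → length (out V F) ≤ length (out U G)
  out-mono U⊆V F⊆G = Sublist.length-mono-≤ (Sublist.filter⁺ _ _ (λ { refl c∉V c∈U → c∉V (U⊆V c∈U) }) F⊆G)

  out-mono-< : ∀ {U V F G c} → (∀ {d} → d ∈ U → d ∈ V) → F ⊆ G → c ∈ out U G → c ∈ V →
               length (out V F) < length (out U G)
  out-mono-< {U} {V} {F} {G} {c} U⊆V F⊆G c∈ c∈V = ⊆-missing⇒length<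
    (Sublist.filter⁺ (λ c → ¬? (c ∈? V)) (λ c → ¬? (c ∈? U)) (λ { refl c∉V c∈U → c∉V (U⊆V c∈U) }) F⊆G) c∈
    λ c∈out → proj₂ (∈-filter⁻ (λ c → ¬? (c ∈? V)) {xs = F} c∈out) c∈V

  -- E lists the forbidden incidences (edge, colour); those with a colour of the used set U are void.
  Slack : List Colour → List Colour → Set
  Slack U E = out U E ≡ [] ⊎ length U + length (out U E) ≤ D

  -- A rung colour that is also forbidden somewhere lowers the number of effective incidences; if none is
  -- available, the forbidden colours are all prescribed, and the incidences of a copy are void or that copy
  -- misses a prescribed colour of the other one.
  choose-rung : (P E : Bool → List Colour) {P∪ E∪ : List Colour} →
    (∀ i → P i ⊆ P∪) → (∀ i → E i ⊆ E∪) → length P∪ + length E∪ ≤ D →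
    ∃ λ r → r ∉ P∪ × (∀ i → Slack (r ∷ P i) (E i))
  choose-rung P E {P∪} {E∪} P⊆ E⊆ bound with out P∪ E∪ in eq
  ... | r ∷ _ = r , r∉P∪ , λ i → inj₂ (begin
          suc (length (P i) + length (out (r ∷ P i) (E i))) ≡⟨ +-suc (length (P i)) _ ⟨
          length (P i) + suc (length (out (r ∷ P i) (E i)))
            ≤⟨ +-mono-≤ (Sublist.length-mono-≤ (P⊆ i)) (⊆-missing⇒length<
                 (⊆-trans (Sublist.filter-⊆ _ (E i)) (E⊆ i)) r∈E∪
                 (λ r∈ → proj₂ (∈-filter⁻ (λ c → ¬? (c ∈? (r ∷ P i))) {xs = E i} r∈) (here refl))) ⟩
          length P∪ + length E∪ ≤⟨ bound ⟩
          D ∎)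
    where
    open ≤-Reasoning
    r∈ = ∈-filter⁻ (λ c → ¬? (c ∈? P∪)) {xs = E∪} (subst (r ∈_) (sym eq) (here refl))
    r∈E∪ = proj₁ r∈
    r∉P∪ = proj₂ r∈
  ... | [] with r , r∉P∪ ← fresh P∪ (≤-trans (m≤m+n _ _) bound) = r , r∉P∪ , slack
    where
    open ≤-Reasoning
    slack : ∀ i → Slack (r ∷ P i) (E i)
    slack i with All.all? (_∈? P i) P∪
    ... | yes P∪⊆Pi = inj₁ (⊆⇒out-[] (E i) λ c∈E →
            there (All.lookup P∪⊆Pi (out-[]⇒⊆ E∪ eq (Sublist.lookup (E⊆ i) c∈E))))
    ... | no P∪⊈Pi with x , x∈P∪ , x∉Pi ← find (All.¬All⇒Any¬ (_∈? P i) P∪ P∪⊈Pi) = inj₂ (begin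
            suc (length (P i) + length (out (r ∷ P i) (E i)))
              ≤⟨ +-mono-≤ (⊆-missing⇒length< (P⊆ i) x∈P∪ x∉Pi)
                          (Sublist.length-mono-≤ (⊆-trans (Sublist.filter-⊆ _ (E i)) (E⊆ i))) ⟩
            length P∪ + length E∪ ≤⟨ bound ⟩
            D ∎)

  -- The pair of copies of a tree edge at a vertex: fix are the prescribed colours, forb the colours
  -- present at the other end, and fixed, forbs count what the two copies share only once.
  record Item : Set where
    field
      fix   : Bool → Maybe Colour
      fixed : List Colour
      forb  : Bool → List Colour
      forbs : List Colour
      fix⊆  : ∀ i → fromMaybe (fix i) ⊆ fixed
      forb⊆ : ∀ i → forb i ⊆ forbs

  open Item public

  weight : Item → ℕ
  weight it = length (fixed it) + length (forbs it)

  weights : List Item → ℕ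
  weights []         = 0
  weights (it ∷ its) = weight it + weights its

  -- A prescribed colour is not tested against `F`: that it suits the other end is known beforehand,
  -- from the precolouring or from the way it was selected.
  data Accepts : Maybe Colour → List Colour → Colour → Set where
    prescribed : ∀ {c F} → Accepts (just c) F c
    chosen     : ∀ {c F} → c ∉ F → Accepts nothing F c

  -- Hall's condition holds because a family violating it needs as many forbidden incidences as
  -- there are unused colours; the greedy choice keeps their number below that.
  extend : ∀ i U its →
    (∀ {c} → just c ∈ map (λ it → fix it i) its → c ∈ U) →
    AllPairs Apart (map (λ it → fix it i) its) →
    length U + frees (map (λ it → fix it i) its) ≤ suc D →
    Slack U (concatMap (λ it → forb it i) its) →
    ∃ λ cs → Pointwise (λ it c → Accepts (fix it i) (forb it i) c) its cs × Unique cs ×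
             All (λ c → c ∉ U ⊎ just c ∈ map (λ it → fix it i) its) cs
  extend i U [] _ _ _ _ = [] , [] , [] , []
  extend i U (it ∷ its) fix∈U (apart ∷ aparts) room slack with fix it i in eq
  -- All prescribed colours lie in `U` from the outset, so keeping `c` consumes no new colour, and
  -- no chosen colour can collide with a later prescribed one.
  ... | just c =
    let cs , acc , uniq , origin = extend i U its (fix∈U ∘ there) aparts room (slack-rest slack)
    in  c ∷ cs , subst (λ m → Accepts m _ c) (sym eq) prescribed ∷ acc
      , All.map (λ { (inj₁ d∉U) refl → d∉U (fix∈U (here refl))
                   ; (inj₂ d∈) refl → All.lookup apart d∈ _ refl refl }) origin ∷ uniq
      , inj₂ (here refl) ∷ All.map [ inj₁ , inj₂ ∘ there ]′ origin
    where
    slack-rest : Slack U (forb it i ++ concatMap (λ it → forb it i) its) → Slack U (concatMap (λ it → forb it i) its)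
    slack-rest (inj₁ e) = inj₁ (⊆⇒out-[] (concatMap (λ it → forb it i) its)
      (out-[]⇒⊆ (forb it i ++ _) e ∘ ∈-++⁺ʳ (forb it i)))
    slack-rest (inj₂ l) = inj₂ (≤-trans (+-monoʳ-≤ (length U)
      (out-mono {U} {U} id (Sublist.++⁺ˡ (forb it i) ⊆-refl))) l)
  ... | nothing with choice slack
    where
    open ≤-Reasoning
    E = concatMap (λ it → forb it i) its
    E′ = forb it i ++ E
    E⊆E′ : E ⊆ E′
    E⊆E′ = Sublist.++⁺ˡ (forb it i) ⊆-refl
    room′ : length U ≤ D
    room′ = ≤-pred (≤-trans (≤-trans (s≤s (m≤m+n _ _)) (≤-reflexive (sym (+-suc (length U) _)))) room)
    choice : Slack U E′ → ∃ λ c → c ∉ U × c ∉ forb it i × Slack (c ∷ U) E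
    choice s with out U (forb it i) in eqF | out U E in eqE
    choice (inj₁ e) | [] | d ∷ _ = case subst (d ∈_) (trans (sym eqE) (⊆⇒out-[] E (out-[]⇒⊆ E′ e ∘ ∈-++⁺ʳ (forb it i)))) (here refl) of λ ()
    -- This edge has no incidences to give up, so its colour must void one: `d` is forbidden on a
    -- later edge and allowed here.
    choice (inj₂ l) | [] | d ∷ _ = d , d∉U , d∉U ∘ out-[]⇒⊆ (forb it i) eqF , inj₂ (begin
        suc (length U + length (out (d ∷ U) E)) ≡⟨ +-suc (length U) _ ⟨
        length U + suc (length (out (d ∷ U) E)) ≤⟨ +-monoʳ-≤ (length U) (out-mono-< {U} {d ∷ U} {E} {E} there ⊆-refl d∈ (here refl)) ⟩
        length U + length (out U E) ≤⟨ +-monoʳ-≤ (length U) (out-mono {U} {U} id E⊆E′) ⟩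
        length U + length (out U E′) ≤⟨ l ⟩
        D ∎)
      where
      d∈ : d ∈ out U E
      d∈ = subst (d ∈_) (sym eqE) (here refl)
      d∉U : d ∉ U
      d∉U = proj₂ (∈-filter⁻ (λ c → ¬? (c ∈? U)) {xs = E} d∈)
    -- No effective incidence is left; only the number of colours matters, which `room` controls.
    choice _ | [] | [] with c , c∉U ← fresh U room′ =
      c , c∉U , c∉U ∘ out-[]⇒⊆ (forb it i) eqF , inj₁ (⊆⇒out-[] E (there ∘ out-[]⇒⊆ E eqE))
    choice (inj₁ e) | d ∷ _ | _ = case subst (d ∈_) (trans (sym eqF) (⊆⇒out-[] (forb it i) (out-[]⇒⊆ E′ e ∘ ∈-++⁺ˡ))) (here refl) of λ ()
    -- The colour added to `U` is paid for by the incidences of this edge, at least one, which leave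
    -- the count.
    choice (inj₂ l) | d ∷ ds | _ with c , c∉ ← fresh (U ++ out U (forb it i)) (begin
        length (U ++ out U (forb it i)) ≡⟨ length-++ U ⟩
        length U + length (out U (forb it i)) ≤⟨ +-monoʳ-≤ (length U) (out-mono {U} {U} {forb it i} id (Sublist.++⁺ʳ E ⊆-refl)) ⟩
        length U + length (out U E′) ≤⟨ l ⟩
        D ∎) =
      c , c∉U , (λ c∈F → c∉ (∈-++⁺ʳ U (∈-filter⁺ (λ c → ¬? (c ∈? U)) c∈F c∉U))) , inj₂ (begin
        suc (length U + length (out (c ∷ U) E)) ≡⟨ +-suc (length U) _ ⟨
        length U + suc (length (out (c ∷ U) E)) ≤⟨ +-monoʳ-≤ (length U) (s≤s (out-mono {U} {c ∷ U} there (⊆-refl {x = E}))) ⟩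
        length U + (1 + length (out U E))
          ≤⟨ +-monoʳ-≤ (length U) (+-monoˡ-≤ (length (out U E)) (subst (λ F → 1 ≤ length F) (sym eqF) (s≤s z≤n))) ⟩
        length U + (length (out U (forb it i)) + length (out U E)) ≡⟨ cong (length U +_) (trans (cong length (filter-++ (λ c → ¬? (c ∈? U)) (forb it i) E)) (length-++ (out U (forb it i)))) ⟨
        length U + length (out U E′) ≤⟨ l ⟩
        D ∎)
      where
      c∉U : c ∉ U
      c∉U = c∉ ∘ ∈-++⁺ˡ
  ... | c , c∉U , c∉F , slack′ =
    let cs , acc , uniq , origin = extend i (c ∷ U) its (there ∘ fix∈U ∘ there) aparts
                                     (≤-trans (≤-reflexive (sym (+-suc (length U) _))) room) slack′
    in  c ∷ cs , subst (λ m → Accepts m _ c) (sym eq) (chosen c∉F) ∷ acc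
      , All.map (λ { (inj₁ d∉) refl → d∉ (here refl)
                   ; (inj₂ d∈) refl → c∉U (fix∈U (there d∈)) }) origin ∷ uniq
      , inj₁ c∉U ∷ All.map [ (λ d∉ → inj₁ (d∉ ∘ there)) , inj₂ ∘ there ]′ origin

module Star (D : ℕ) where
  open Palette D public

  catMaybes-fix⊆ : ∀ i its → catMaybes (map (λ it → fix it i) its) ⊆ concatMap fixed its
  catMaybes-fix⊆ i [] = []
  catMaybes-fix⊆ i (it ∷ its) with fix it i | fix⊆ it i
  ... | just c  | s = Sublist.++⁺ s (catMaybes-fix⊆ i its)
  ... | nothing | s = Sublist.++⁺ s (catMaybes-fix⊆ i its)

  forb⊆forbs : ∀ i its → concatMap (λ it → forb it i) its ⊆ concatMap forbs its
  forb⊆forbs i []         = []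
  forb⊆forbs i (it ∷ its) = Sublist.++⁺ (forb⊆ it i) (forb⊆forbs i its)

  weights-split : ∀ its → weights its ≡ length (concatMap fixed its) + length (concatMap forbs its)
  weights-split [] = refl
  weights-split (it ∷ its) rewrite weights-split its | length-++ (fixed it) {concatMap fixed its} | length-++ (forbs it) {concatMap forbs its} =
    interchange (length (fixed it)) (length (forbs it)) (length (concatMap fixed its)) (length (concatMap forbs its))

  -- The copies share only the rung, so once its colour leaves slack in both they are completed
  -- independently. With at most `D` other edges, the rung may take one of the `suc D` colours.
  colour-star : ∀ (ρ : Maybe Colour) its → length its ≤ D → length (fromMaybe ρ) + weights its ≤ D →
    (∀ i → AllPairs Apart (ρ ∷ map (λ it → fix it i) its)) →
    ∃ λ r → (∀ {c} → ρ ≡ just c → r ≡ c) × ∃ λ βs →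
      Pointwise (λ it β → ∀ i → Accepts (fix it i) (forb it i) (at i β)) its βs ×
      (∀ i → Unique (r ∷ map (at i) βs))
  colour-star ρ its few light apart =
    let r , r≡ρ , r∉ , slack = rung ρ light apart
        cs₀ , acc₀ , u₀ , or₀ = copy r r∉ slack false
        cs₁ , acc₁ , u₁ , or₁ = copy r r∉ slack true
        βs , acc , e₀ , e₁ = zip-pointwise acc₀ acc₁
    in r , r≡ρ , βs
     , Pointwise.map (λ { (a , b) false → a ; (a , b) true → b }) acc
     , λ { false → subst (λ cs → Unique (r ∷ cs)) (sym e₀) (r∉cs r∉ or₀ ∷ u₀)
         ; true  → subst (λ cs → Unique (r ∷ cs)) (sym e₁) (r∉cs r∉ or₁ ∷ u₁) }
    where
    open ≤-Reasoning
    fixes : Bool → List (Maybe Colour)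
    fixes i = map (λ it → fix it i) its
    P E : Bool → List Colour
    P i = catMaybes (fixes i)
    E i = concatMap (λ it → forb it i) its

    rung : ∀ ρ → length (fromMaybe ρ) + weights its ≤ D → (∀ i → AllPairs Apart (ρ ∷ fixes i)) →
      ∃ λ r → (∀ {c} → ρ ≡ just c → r ≡ c) × (∀ i → just r ∉ fixes i) × (∀ i → Slack (r ∷ P i) (E i))
    rung nothing light apart =
      let r , r∉ , slack = choose-rung P E (λ i → catMaybes-fix⊆ i its) (λ i → forb⊆forbs i its)
                             (≤-trans (≤-reflexive (sym (weights-split its))) light)
      in r , (λ ()) , (λ i r∈ → r∉ (Sublist.lookup (catMaybes-fix⊆ i its) (∈-catMaybes⁺ r∈))) , slack
    -- A precoloured rung is itself counted in `light`; this unit pays for adding `r` to the used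
    -- colours.
    rung (just r) light apart =
      r , just-injective , (λ i r∈ → All.lookup (AllPairs.head (apart i)) r∈ _ refl refl)
      , λ i → inj₂ (begin
          suc (length (P i) + length (out (r ∷ P i) (E i)))
            ≤⟨ s≤s (+-mono-≤ (Sublist.length-mono-≤ (catMaybes-fix⊆ i its))
                 (Sublist.length-mono-≤ (⊆-trans (Sublist.filter-⊆ _ (E i)) (forb⊆forbs i its)))) ⟩
          suc (length (concatMap fixed its) + length (concatMap forbs its)) ≡⟨ cong suc (weights-split its) ⟨
          suc (weights its) ≤⟨ light ⟩
          D ∎)

    copy : ∀ r → (∀ i → just r ∉ fixes i) → (∀ i → Slack (r ∷ P i) (E i)) → ∀ i → _
    copy r r∉ slack i = extend i (r ∷ P i) its (there ∘ ∈-catMaybes⁺) (AllPairs.tail (apart i))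
      (s≤s (begin
        length (P i) + frees (fixes i) ≡⟨ length-catMaybes+frees (fixes i) ⟩
        length (fixes i)               ≡⟨ length-map _ its ⟩
        length its                     ≤⟨ few ⟩
        D ∎)) (slack i)

    r∉cs : ∀ {r i cs} → (∀ i → just r ∉ fixes i) → All (λ c → c ∉ r ∷ P i ⊎ just c ∈ fixes i) cs → All (r ≢_) cs
    r∉cs {i = i} r∉ = All.map λ { (inj₁ c∉) refl → c∉ (here refl) ; (inj₂ c∈) refl → r∉ i c∈ }

-- Rooted trees with precoloured slots: costs, items and the induction hypothesis.

data Tree (V : Set) : Set where
  node : V → List (Tree V) → Tree V

root : {V : Set} → Tree V → V
root (node u _) = u

children : {V : Set} → Tree V → List (Tree V)
children (node _ ts) = ts

-- The slot (v , nothing) is the rung at v; (v , just i) is copy i of the edge from v to its parent.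
Slot : Set → Set
Slot V = V × Maybe Bool

module Rooted (D : ℕ) {V : Set} (pre : Slot V → Maybe (Fin (suc D))) where
  open Star D public

  ρ : Tree V → Maybe Colour
  ρ t = pre (root t , nothing)

  π : Bool → Tree V → Maybe Colour
  π i t = pre (root t , just i)

  star : Bool → Tree V → List (Maybe Colour)
  star i t = ρ t ∷ map (π i) (children t)

  _Matches_ : Colour → Maybe Colour → Set
  b Matches m = ∀ {c} → m ≡ just c → b ≡ c

  -- The list holds the colours of the edges from the root of the tree to vertices outside it.
  data Coloured : List (Colour × Colour) → Tree V → Set where
    coloured : ∀ {αs u ts} r → r Matches (ρ (node u ts)) → ∀ βs →
      Pointwise (λ t β → Coloured [ β ] t × (∀ i → at i β Matches (π i t))) ts βs →
      (∀ i → Unique (r ∷ map (at i) (αs ++ βs))) →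
      Coloured αs (node u ts)

  #_ : Maybe Colour → ℕ
  # m = length (fromMaybe m)

  -- The number of precoloured edges, not counting the two copies of the edge above the root.
  cost : Tree V → ℕ
  costs : List (Tree V) → ℕ
  cost (node u ts) = # (ρ (node u ts)) + costs ts
  costs []       = 0
  costs (t ∷ ts) = (# (π false t) + # (π true t) + cost t) + costs ts

  merge : Maybe Colour → Maybe Colour → List Colour
  merge nothing  n       = fromMaybe n
  merge (just a) nothing = [ a ]
  merge (just a) (just b) with a ≟ b
  ... | yes _ = [ a ]
  ... | no _  = a ∷ b ∷ []

  -- A monochromatic pair (a , a) blocks only one colour at each end, hence counts once.
  fixes : (Bool → Maybe Colour) → List Colour
  fixes q = merge (q false) (q true)

  fromMaybe⊆fixes : ∀ q i → fromMaybe (q i) ⊆ fixes q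
  fromMaybe⊆fixes q i with q false in e | q true in e′ | i
  ... | nothing | n | false rewrite e = Sublist.[]⊆-universal _
  ... | nothing | n | true  rewrite e′ = ⊆-refl
  ... | just a | nothing | false rewrite e = ⊆-refl
  ... | just a | nothing | true  rewrite e′ = Sublist.[]⊆-universal _
  ... | just a | just b | i with a ≟ b | i
  ... | yes refl | false rewrite e = ⊆-refl
  ... | yes refl | true  rewrite e′ = ⊆-refl
  ... | no _ | false rewrite e = refl ∷ Sublist.[]⊆-universal _
  ... | no _ | true  rewrite e′ = a ∷ʳ ⊆-refl

  length-fixes≤ : ∀ q → length (fixes q) ≤ # (q false) + # (q true)
  length-fixes≤ q with q false | q true
  ... | nothing | n = ≤-refl
  ... | just a | nothing = ≤-refl
  ... | just a | just b with a ≟ b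
  ... | yes _ = s≤s z≤n
  ... | no _  = ≤-refl

  length-fixes-twin : ∀ a → length (fixes (λ _ → just a)) ≡ 1
  length-fixes-twin a with a ≟ a
  ... | yes _ = refl
  ... | no a≢a = contradiction refl a≢a

  -- Nothing is forbidden, as no look-ahead is needed: the pair is already known to suit the branch
  -- below, or it leads upwards and the vertex above is handled separately.
  pinned : (Bool → Maybe Colour) → Item
  pinned q = record
    { fix = q ; fixed = fixes q ; forb = λ _ → [] ; forbs = []
    ; fix⊆ = fromMaybe⊆fixes q ; forb⊆ = λ _ → [] }

  -- The forbidden colours are a look-ahead by one level, to the star of the child. Its rung lies in
  -- both copies but enters `forbs` once, so that every incidence there is charged to its own
  -- precoloured edge.
  branch : Tree V → Item
  branch t = record
    { fix = λ i → π i t ; fixed = fixes (λ i → π i t)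
    ; forb = λ i → fromMaybe (ρ t) ++ catMaybes (map (π i) (children t))
    ; forbs = fromMaybe (ρ t) ++ catMaybes (map (π false) (children t)) ++ catMaybes (map (π true) (children t))
    ; fix⊆ = fromMaybe⊆fixes _
    ; forb⊆ = λ { false → Sublist.++⁺ (⊆-refl {x = fromMaybe (ρ t)}) (Sublist.++⁺ʳ _ ⊆-refl)
                ; true → Sublist.++⁺ (⊆-refl {x = fromMaybe (ρ t)}) (Sublist.++⁺ˡ _ ⊆-refl) } }

  length-π≤costs : ∀ ts → length (catMaybes (map (π false) ts)) + length (catMaybes (map (π true) ts)) ≤ costs ts
  length-π≤costs [] = z≤n
  length-π≤costs (t ∷ ts)
    rewrite length-catMaybes-∷ (π false t) (map (π false) ts) | length-catMaybes-∷ (π true t) (map (π true) ts) = begin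
      (# (π false t) + x) + (# (π true t) + y) ≡⟨ interchange (# (π false t)) x (# (π true t)) y ⟩
      (# (π false t) + # (π true t)) + (x + y) ≤⟨ +-mono-≤ (m≤m+n _ (cost t)) (length-π≤costs ts) ⟩
      (# (π false t) + # (π true t) + cost t) + costs ts ∎
    where
    open ≤-Reasoning
    x = length (catMaybes (map (π false) ts))
    y = length (catMaybes (map (π true) ts))

  length-forbs≤cost : ∀ t → length (forbs (branch t)) ≤ cost t
  length-forbs≤cost t@(node u ts)
    rewrite length-++ (fromMaybe (ρ t)) {catMaybes (map (π false) ts) ++ catMaybes (map (π true) ts)}
          | length-++ (catMaybes (map (π false) ts)) {catMaybes (map (π true) ts)} = +-monoʳ-≤ (# (ρ t)) (length-π≤costs ts)

  -- The charging argument: a branch pays for its item with its own precoloured edges, so the items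
  -- at a vertex never weigh more than the budget.
  weight-branch≤ : ∀ t → weight (branch t) ≤ # (π false t) + # (π true t) + cost t
  weight-branch≤ t = +-mono-≤ (length-fixes≤ (λ i → π i t)) (length-forbs≤cost t)

  -- The first index is the number of edges from the root of the tree to vertices outside it.
  data Tame : ℕ → Tree V → Set where
    tame : ∀ {k u ts} → k + length ts ≤ D → (∀ i → AllPairs Apart (star i (node u ts))) →
      All (λ t → (∀ i → All (Apart (π i t)) (star i t)) × Tame 1 t) ts → Tame k (node u ts)

  -- A full `q` is a pair imposed from above, with `length (fixes q)` equal to one or two. A partial
  -- `q`, such as the precolouring itself, lets a branch be coloured before its parent.
  Solvable : Tree V → Set
  Solvable t = ∀ q → cost t + length (fixes q) ≤ D → (∀ i → All (Apart (q i)) (star i t)) →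
    ∃ λ β → (∀ i → at i β Matches (q i)) × Coloured [ β ] t

  -- The contract between a star and a branch. The item may be stricter than the precolouring of the
  -- pair, as with a pinned one.
  Serves : Item → Tree V → Set
  Serves it t = ∀ β → (∀ i → Accepts (fix it i) (forb it i) (at i β)) →
    Coloured [ β ] t × (∀ i → at i β Matches (π i t))

  at-injective : {p q : Colour × Colour} → (∀ i → at i p ≡ at i q) → p ≡ q
  at-injective e = cong₂ _,_ (e false) (e true)

  accepts⇒extends : ∀ {m F c} → Accepts m F c → c Matches m
  accepts⇒extends prescribed refl = refl

  apart-≢ : ∀ {m : Maybe Colour} {c} → ¬ (m ≡ just c) → Apart (just c) m
  apart-≢ ne _ refl e = ne e

  ∈-star⁻ : ∀ i t {m c} → m ∈ star i t → m ≡ just c → c ∈ forb (branch t) i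
  ∈-star⁻ i t (here refl) e = ∈-++⁺ˡ (∈-fromMaybe e)
  ∈-star⁻ i t (there m∈) refl = ∈-++⁺ʳ (fromMaybe (ρ t)) (∈-catMaybes⁺ m∈)

  #-zero : ∀ {m} → # m ≡ 0 → m ≡ nothing
  #-zero {nothing} _ = refl

  module _ (2≤D : 2 ≤ D) where

    Avoids : List Colour → Maybe Colour → Set
    Avoids U m = ∀ c → m ≡ just c → c ∉ U

    record Head (used : Bool → List Colour) (b : ℕ) (t : Tree V) (ts : List (Tree V)) : Set where
      field
        item   : Item
        serves : Serves item t
        light  : (b + weight item) + costs ts ≤ D
        unused : ∀ i → Avoids (used i) (fix item i)
        apart  : ∀ i → All (λ t′ → Apart (fix item i) (π i t′)) ts

    avoid-star : ∀ i t {m′ c m} → All (Apart m′) (star i t) → Accepts m′ (forb (branch t) i) c →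
                 m ∈ star i t → Apart (just c) m
    avoid-star i t apart prescribed m∈ = All.lookup apart m∈
    avoid-star i t apart (chosen c∉) m∈ = apart-≢ (c∉ ∘ ∈-star⁻ i t m∈)

    -- A pair counts at most two whatever its colours. It suits the star of the child because chosen
    -- colours avoid `forb` and prescribed ones come from a proper precolouring.
    serve-branch : ∀ {t} → Solvable t → cost t + 2 ≤ D → (∀ i → All (Apart (π i t)) (star i t)) → Serves (branch t) t
    serve-branch {t} solve small apart β acc
      with β′ , β′≡β , col ← solve (λ i → just (at i β))
             (≤-trans (+-monoʳ-≤ (cost t) (length-fixes≤ (λ i → just (at i β)))) small)
             (λ i → All.tabulate λ m∈ → avoid-star i t (apart i) (acc i) m∈)
      with refl ← at-injective {β′} {β} (λ i → β′≡β i refl) = col , λ i → accepts⇒extends (acc i)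

    serve-pinned : ∀ {t β} → Coloured [ β ] t → (∀ i → at i β Matches (π i t)) → Serves (pinned (λ i → just (at i β))) t
    serve-pinned {β = β} col match β′ acc with refl ← at-injective {β′} {β} (λ i → accepts⇒extends (acc i) refl) = col , match

    -- A monochromatic pair counts one, so it is affordable where an arbitrary pair is not.
    serve-twin : ∀ {t x} → Solvable t → (∀ i → π i t ≡ nothing) → cost t + 1 ≤ D → x ∉ forbs (branch t) →
      Serves (pinned (λ _ → just x)) t
    serve-twin {t} {x} solve bare small x∉ β′ acc =
      let β , β≡x , col = solve (λ _ → just x)
            (≤-trans (≤-reflexive (cong (cost t +_) (length-fixes-twin x))) small)
            (λ i → All.tabulate λ m∈ → apart-≢ λ e → x∉ (Sublist.lookup (forb⊆ (branch t) i) (∈-star⁻ i t m∈ e)))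
      in subst (λ β → Coloured [ β ] t)
               (at-injective {β} {β′} (λ i → trans (β≡x i refl) (sym (accepts⇒extends (acc i) refl)))) col
       , λ i e → case trans (sym (bare i)) e of λ ()

    -- A branch with at most D - 2 precoloured edges accepts any colours above it.  One with D - 1, and none
    -- above it, gets a monochromatic pair.  Otherwise it carries all precoloured edges and is coloured first.
    head : ∀ used K b t ts → Solvable t → (∀ i → All (Apart (π i t)) (star i t)) →
      (∀ i {c} → c ∈ used i → c ∈ K) → length K ≤ b → b + costs (t ∷ ts) ≤ D →
      (∀ i → Avoids (used i) (π i t)) → (∀ i → All (λ t′ → Apart (π i t) (π i t′)) ts) →
      Head used b t ts
    head used K b t ts solve clash used⊆K K≤b light unused apart with cost t + 2 ≤? D
    ... | yes small = record
      { item = branch t ; serves = serve-branch solve small clash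
      ; light = lighter (weight-branch≤ t)
      ; unused = unused ; apart = apart }
      where
      lighter : ∀ {w} → w ≤ # (π false t) + # (π true t) + cost t → (b + w) + costs ts ≤ D
      lighter w≤ = ≤-trans (≤-reflexive (+-assoc b _ _)) (≤-trans (+-monoʳ-≤ b (+-monoˡ-≤ (costs ts) w≤)) light)
    ... | no big with # (π false t) + # (π true t) + cost t ≤? D ∸ 1
    ... | yes almost = record
      { item = pinned (λ _ → just x) ; serves = serves
      -- The twin weighs 1, and the branch can pay, having at least `D - 1 ≥ 1` precoloured edges.
      ; light = lighter (≤-trans (≤-reflexive (trans (+-identityʳ _) (length-fixes-twin x)))
                          (≤-trans (≤-pred (≤-trans 2≤D D≤1+cost)) (m≤n+m (cost t) p)))
      ; unused = λ { i _ refl x∈ → x∉ (∈-++⁺ˡ (used⊆K i x∈)) }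
      ; apart = λ i → All.tabulate λ t′∈ → apart-≢ λ e →
          x∉π i (∈-catMaybes⁺ (subst (_∈ map (π i) ts) e (∈-map⁺ (π i) t′∈))) }
      where
      open ≤-Reasoning
      p = # (π false t) + # (π true t)
      lighter : ∀ {w} → w ≤ p + cost t → (b + w) + costs ts ≤ D
      lighter w≤ = ≤-trans (≤-reflexive (+-assoc b _ _)) (≤-trans (+-monoʳ-≤ b (+-monoˡ-≤ (costs ts) w≤)) light)
      A B : List Colour
      A = forbs (branch t)
      B = catMaybes (map (π false) ts) ++ catMaybes (map (π true) ts)
      -- `K` holds the colours settled so far, `A` those precoloured at the child, `B` those
      -- precoloured on the edges to later siblings; they are charged to `b`, `cost t` and
      -- `costs ts` respectively.
      found : ∃ λ x → x ∉ K ++ A ++ B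
      found = fresh (K ++ A ++ B) (begin
        length (K ++ A ++ B) ≡⟨ trans (length-++ K) (cong (length K +_) (length-++ A)) ⟩
        length K + (length A + length B) ≤⟨ +-mono-≤ K≤b (+-mono-≤
            (≤-trans (length-forbs≤cost t) (m≤n+m (cost t) p))
            (≤-trans (≤-reflexive (length-++ (catMaybes (map (π false) ts)))) (length-π≤costs ts))) ⟩
        b + costs (t ∷ ts) ≤⟨ light ⟩
        D ∎)
      x = proj₁ found
      x∉ = proj₂ found
      x∉π : ∀ i → x ∉ catMaybes (map (π i) ts)
      x∉π false = x∉ ∘ ∈-++⁺ʳ K ∘ ∈-++⁺ʳ A ∘ ∈-++⁺ˡ
      x∉π true  = x∉ ∘ ∈-++⁺ʳ K ∘ ∈-++⁺ʳ A ∘ ∈-++⁺ʳ (catMaybes (map (π false) ts))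
      D≤1+cost : D ≤ suc (cost t)
      D≤1+cost = ≤-pred (≤-trans (≰⇒> big) (≤-reflexive (+-comm (cost t) 2)))
      -- Squeezed by the two tests: `p + cost t ≤ D - 1 ≤ cost t`.
      p≡0 : p ≡ 0
      p≡0 = n≤0⇒n≡0 (+-cancelʳ-≤ (cost t) p 0 (≤-trans almost (∸-monoˡ-≤ 1 D≤1+cost)))
      bare : ∀ i → π i t ≡ nothing
      bare false = #-zero (m+n≡0⇒m≡0 (# (π false t)) p≡0)
      bare true  = #-zero (m+n≡0⇒n≡0 (# (π false t)) p≡0)
      serves : Serves (pinned (λ _ → just x)) t
      serves = serve-twin solve bare
        (begin
           cost t + 1 ≡⟨ +-comm (cost t) 1 ⟩
           suc (cost t) ≤⟨ s≤s (≤-trans (m≤n+m (cost t) p) almost) ⟩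
           1 + (D ∸ 1) ≡⟨ m+[n∸m]≡n (≤-trans (s≤s z≤n) 2≤D) ⟩
           D ∎)
        (λ x∈ → x∉ (∈-++⁺ʳ K (∈-++⁺ˡ x∈)))
    ... | no full = record
      { item = pinned (λ i → just (at i β)) ; serves = serve-pinned col match
      -- Nothing else at this vertex has weight, so even two different colours fit, by `2 ≤ D`.
      ; light = subst (λ n → n + costs ts ≤ D) (sym (cong (_+ weight it) b≡0))
          (subst (λ n → weight it + n ≤ D) (sym costs≡0) (≤-trans (≤-reflexive (trans (+-identityʳ _) (+-identityʳ _)))
            (≤-trans (length-fixes≤ (λ i → just (at i β))) 2≤D)))
      ; unused = λ i _ _ c∈ → <-irrefl refl (≤-trans (∈-length (used⊆K i c∈)) (≤-trans K≤b (≤-reflexive b≡0)))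
      ; apart = λ i → All.tabulate λ t′∈ → apart-≢ λ e →
          none i (∈-catMaybes⁺ (subst (_∈ map (π i) ts) e (∈-map⁺ (π i) t′∈))) }
      where
      open ≤-Reasoning
      p = # (π false t) + # (π true t)
      D≤ : D ≤ p + cost t
      D≤ = ≤-trans (≤-reflexive (sym (m+[n∸m]≡n (≤-trans (s≤s z≤n) 2≤D)))) (≰⇒> full)
      -- This branch alone exhausts the budget.
      rest≡0 : b + costs ts ≡ 0
      rest≡0 = n≤0⇒n≡0 (+-cancelˡ-≤ (p + cost t) (b + costs ts) 0 (begin
        (p + cost t) + (b + costs ts) ≡⟨ +-assoc (p + cost t) b (costs ts) ⟨
        ((p + cost t) + b) + costs ts ≡⟨ cong (_+ costs ts) (+-comm (p + cost t) b) ⟩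
        (b + (p + cost t)) + costs ts ≡⟨ +-assoc b (p + cost t) (costs ts) ⟩
        b + ((p + cost t) + costs ts) ≤⟨ light ⟩
        D ≤⟨ D≤ ⟩
        p + cost t ≡⟨ +-identityʳ _ ⟨
        (p + cost t) + 0 ∎))
      b≡0 : b ≡ 0
      b≡0 = m+n≡0⇒m≡0 b rest≡0
      costs≡0 : costs ts ≡ 0
      costs≡0 = m+n≡0⇒n≡0 b rest≡0
      none : ∀ i {c} → c ∉ catMaybes (map (π i) ts)
      none false c∈ = <-irrefl refl (≤-trans (∈-length c∈) (≤-trans (m≤m+n _ _) (≤-trans (length-π≤costs ts) (≤-reflexive costs≡0))))
      none true c∈ = <-irrefl refl (≤-trans (∈-length c∈) (≤-trans (m≤n+m _ _) (≤-trans (length-π≤costs ts) (≤-reflexive costs≡0))))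
      -- The only prescription is the precolouring of the pair itself; the outcome `β` is then
      -- pinned for the parent.
      sol = solve (λ i → π i t) (begin
        cost t + length (fixes (λ i → π i t)) ≤⟨ +-monoʳ-≤ (cost t) (length-fixes≤ (λ i → π i t)) ⟩
        cost t + p ≡⟨ +-comm (cost t) p ⟩
        p + cost t ≤⟨ m≤m+n _ _ ⟩
        (p + cost t) + costs ts ≤⟨ m≤n+m _ b ⟩
        b + costs (t ∷ ts) ≤⟨ light ⟩
        D ∎) clash
      β = proj₁ sol
      match = proj₁ (proj₂ sol)
      col = proj₂ (proj₂ sol)
      it = pinned (λ i → just (at i β))

    -- Turning a branch into an item exchanges its cost for its weight in the budget. `used` is kept
    -- per copy, while `K` joins the copies because a twin must avoid both; it also collects newly
    -- pinned colours.
    heads : ∀ used K b ts → All Solvable ts → All (λ t → ∀ i → All (Apart (π i t)) (star i t)) ts →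
      (∀ i {c} → c ∈ used i → c ∈ K) → length K ≤ b → b + costs ts ≤ D →
      (∀ i → All (λ t → Avoids (used i) (π i t)) ts) → (∀ i → AllPairs Apart (map (π i) ts)) →
      ∃ λ its → Pointwise Serves its ts × b + weights its ≤ D ×
        (∀ i → All (λ it → Avoids (used i) (fix it i)) its) ×
        (∀ i → AllPairs Apart (map (λ it → fix it i) its))
    heads used K b [] _ _ _ _ light _ _ = [] , [] , light , (λ i → []) , λ i → []
    heads used K b (t ∷ ts) (solve ∷ solves) (clash ∷ clashes) used⊆K K≤b light unused apart =
      let its , serves , light′ , unused′ , apart′ = heads used′ (fixed it ++ K) (b + weight it) ts solves clashes
            (λ i c∈ → [ (λ c∈′ → ∈-++⁺ˡ (Sublist.lookup (fix⊆ it i) c∈′)) , ∈-++⁺ʳ (fixed it) ∘ used⊆K i ]′ (∈-++⁻ (fromMaybe (fix it i)) c∈))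
            (begin
              length (fixed it ++ K) ≡⟨ length-++ (fixed it) ⟩
              length (fixed it) + length K ≤⟨ +-mono-≤ (m≤m+n _ _) K≤b ⟩
              weight it + b ≡⟨ +-comm (weight it) b ⟩
              b + weight it ∎)
            (Head.light h)
            (λ i → All.zipWith (λ { (ap , un) c e c∈ → [ (λ c∈′ → clashes-fix c∈′ ap e) , un c e ]′ (∈-++⁻ (fromMaybe (fix it i)) c∈)})
               (Head.apart h i , All.tail (unused i)))
            (λ i → AllPairs.tail (apart i))
      in it ∷ its , Head.serves h ∷ serves
       , ≤-trans (≤-reflexive (sym (+-assoc b _ _))) light′
       , (λ i → Head.unused h i ∷ All.map (λ un c e → un c e ∘ ∈-++⁺ʳ (fromMaybe (fix it i))) (unused′ i))
       , (λ i → All.map⁺ (All.map (λ un c e e′ → un c e′ (∈-++⁺ˡ (∈-fromMaybe e))) (unused′ i)) ∷ apart′ i)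
      where
      open ≤-Reasoning
      h : Head used b t ts
      h = head used K b t ts solve clash used⊆K K≤b light (λ i → All.head (unused i))
            (λ i → All.map⁻ (AllPairs.head (apart i)))
      it = Head.item h
      clashes-fix : ∀ {m m′ : Maybe Colour} {c} → c ∈ fromMaybe m → Apart m m′ → ¬ (m′ ≡ just c)
      clashes-fix {just _} (here refl) ap = ap _ refl
      used′ : Bool → List Colour
      used′ i = fromMaybe (fix it i) ++ used i

    weights-++ : ∀ its jts → weights (its ++ jts) ≡ weights its + weights jts
    weights-++ [] jts = refl
    weights-++ (it ∷ its) jts = trans (cong (weight it +_) (weights-++ its jts)) (sym (+-assoc (weight it) _ _))

    serve : ∀ {its ts βs} → Pointwise Serves its ts →
      Pointwise (λ it β → ∀ i → Accepts (fix it i) (forb it i) (at i β)) its βs →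
      Pointwise (λ t β → Coloured [ β ] t × (∀ i → at i β Matches (π i t))) ts βs
    serve [] [] = []
    serve (s ∷ ss) (acc ∷ accs) = s _ acc ∷ serve ss accs

    used : List Item → Tree V → Bool → List Colour
    used ps t i = fromMaybe (ρ t) ++ catMaybes (map (λ p → fix p i) ps)

    used∪ : List Item → Tree V → List Colour
    used∪ ps t = fromMaybe (ρ t) ++ concatMap fixed ps

    used⊆used∪ : ∀ ps t i {c} → c ∈ used ps t i → c ∈ used∪ ps t
    used⊆used∪ ps t i = Sublist.lookup (Sublist.++⁺ (⊆-refl {x = fromMaybe (ρ t)}) (catMaybes-fix⊆ i ps))

    length-used∪≤ : ∀ ps t → length (used∪ ps t) ≤ # (ρ t) + weights ps
    length-used∪≤ ps t = begin
      length (used∪ ps t)                                                      ≡⟨ length-++ (fromMaybe (ρ t)) ⟩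
      # (ρ t) + length (concatMap fixed ps)                                    ≤⟨ +-monoʳ-≤ (# (ρ t)) (m≤m+n _ _) ⟩
      # (ρ t) + (length (concatMap fixed ps) + length (concatMap forbs ps))    ≡⟨ cong (# (ρ t) +_) (weights-split ps) ⟨
      # (ρ t) + weights ps ∎
      where open ≤-Reasoning

    child-unused : ∀ ps t i → AllPairs Apart (star i t) → All (λ p → All (Apart (fix p i)) (star i t)) ps →
      All (λ t′ → Avoids (used ps t i) (π i t′)) (children t)
    child-unused ps t i aparts stars = All.tabulate λ t′∈ c e c∈ →
      [ (λ c∈ρ → All.lookup (AllPairs.head aparts) (∈-map⁺ (π i) t′∈) c (∈-fromMaybe⁻ c∈ρ) e)
      , (λ c∈ps → case ∈-map⁻ (λ p → fix p i) (∈-catMaybes⁻ c∈ps) of λ { (p , p∈ , eq) →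
           All.lookup (All.lookup stars p∈) (there (∈-map⁺ (π i) t′∈)) c (sym eq) e }) ]′
      (∈-++⁻ (fromMaybe (ρ t)) c∈)

    all-apart : ∀ ps its t i → AllPairs Apart (map (λ p → fix p i) ps) → All (λ p → All (Apart (fix p i)) (star i t)) ps →
      All (λ it → Avoids (used ps t i) (fix it i)) its → AllPairs Apart (map (λ it → fix it i) its) →
      AllPairs Apart (ρ t ∷ map (λ it → fix it i) (ps ++ its))
    all-apart ps its t i apart stars unused apart′ =
      subst (λ ms → AllPairs Apart (ρ t ∷ ms)) (sym (map-++ _ ps its))
        (All.++⁺ (All.map⁺ (All.map (λ ap c e e′ → All.head ap c e′ e) stars))
                 (All.map⁺ (All.map (λ un c e e′ → un c e′ (∈-++⁺ˡ (∈-fromMaybe e))) unused))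
         ∷ AllPairs.++⁺ apart apart′ (All.tabulate λ m∈ → All.map⁺ (All.map (λ un c e e′ →
             un c e′ (∈-++⁺ʳ (fromMaybe (ρ t)) (∈-catMaybes⁺ (subst (_∈ _) e m∈)))) unused)))

    -- ps are the edges from the root of the tree to vertices outside it.
    solve-node : ∀ ps {t} → All Solvable (children t) → Tame (length ps) t → weights ps + cost t ≤ D →
      (∀ i → All (λ p → All (Apart (fix p i)) (star i t)) ps) →
      (∀ i → AllPairs Apart (map (λ p → fix p i) ps)) →
      ∃ λ αs → Pointwise (λ p α → ∀ i → Accepts (fix p i) (forb p i) (at i α)) ps αs × Coloured αs t
    solve-node ps {t@(node u ts)} solves (tame few aparts clashes) light stars apart
      = let its , serves , light′ , unused , its-apart =
              heads (used ps t) (used∪ ps t) (# (ρ t) + weights ps) ts solves (All.map proj₁ clashes)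
                (used⊆used∪ ps t) (length-used∪≤ ps t)
                (≤-trans (≤-reflexive (trans (cong (_+ costs ts) (+-comm (# (ρ t)) (weights ps))) (+-assoc (weights ps) _ _))) light)
                (λ i → child-unused ps t i (aparts i) (stars i))
                (λ i → AllPairs.tail (aparts i))
            r , r≡ρ , γs , acc , uniq = colour-star (ρ t) (ps ++ its)
              (≤-trans (≤-reflexive (trans (length-++ ps) (cong (length ps +_) (Pointwise.Pointwise-length serves)))) few)
              (≤-trans (≤-reflexive (trans (cong (# (ρ t) +_) (weights-++ ps its)) (sym (+-assoc (# (ρ t)) _ _)))) light′)
              (λ i → all-apart ps its t i (apart i) (stars i) (unused i) (its-apart i))
            αs , βs , γs≡ , acc₁ , acc₂ = pointwise-++⁻ ps acc
        in αs , acc₁ , coloured r r≡ρ βs (serve serves acc₂)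
             (λ i → subst (λ γs → Unique (r ∷ map (at i) γs)) γs≡ (uniq i))

    -- The pair above the vertex is one more item of its star, so whatever `q` leaves open is
    -- coloured together with the edges to the children.
    solvable : ∀ {t} → All Solvable (children t) → Tame 1 t → Solvable t
    solvable {t} solves calm q light apart =
      single (solve-node (pinned q ∷ []) solves calm
        (≤-trans (≤-reflexive (trans (cong (_+ cost t) (trans (+-identityʳ _) (+-identityʳ _))) (+-comm (length (fixes q)) (cost t)))) light)
        (λ i → apart i ∷ []) (λ i → [] ∷ []))
      where
      single : (∃ λ αs → Pointwise (λ p α → ∀ i → Accepts (fix p i) (forb p i) (at i α)) (pinned q ∷ []) αs × Coloured αs t) →
        ∃ λ β → (∀ i → at i β Matches (q i)) × Coloured [ β ] t
      single (α ∷ [] , acc ∷ [] , col) = α , (λ i → accepts⇒extends (acc i)) , col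

    solve : ∀ t → Tame 1 t → Solvable t
    solves : ∀ ts → All (λ t → (∀ i → All (Apart (π i t)) (star i t)) × Tame 1 t) ts → All Solvable ts
    solve (node u ts) calm@(tame _ _ subs) = solvable (solves ts subs) calm
    solves [] [] = []
    solves (t ∷ ts) ((_ , calm) ∷ calms) = solve t calm ∷ solves ts calms

    solve-root : ∀ t → Tame 0 t → cost t ≤ D → Coloured [] t
    solve-root t@(node u ts) calm@(tame _ _ subs) light =
      none (solve-node [] (solves ts subs) calm light (λ _ → []) (λ _ → []))
      where
      none : (∃ λ αs → Pointwise (λ p α → ∀ i → Accepts (fix p i) (forb p i) (at i α)) [] αs × Coloured αs t) → Coloured [] t
      none ([] , [] , col) = col

-- Labels and links of a rooted tree, and grafting of leaves.

module _ {V : Set} where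

  labels : Tree V → List V
  labelss : List (Tree V) → List V
  labels (node u ts) = u ∷ labelss ts
  labelss []       = []
  labelss (t ∷ ts) = labels t ++ labelss ts

  links : Tree V → List (V × V)
  linkss : V → List (Tree V) → List (V × V)
  links (node u ts) = linkss u ts
  linkss u []       = []
  linkss u (t ∷ ts) = (u , root t) ∷ links t ++ linkss u ts

  labels≡root∷targets : ∀ t → labels t ≡ root t ∷ map proj₂ (links t)
  labelss≡targets : ∀ u ts → labelss ts ≡ map proj₂ (linkss u ts)
  labels≡root∷targets (node u ts) = cong (u ∷_) (labelss≡targets u ts)
  labelss≡targets u [] = refl
  labelss≡targets u (t ∷ ts) = trans (cong₂ _++_ (labels≡root∷targets t) (labelss≡targets u ts))
    (cong (root t ∷_) (sym (map-++ proj₂ (links t) (linkss u ts))))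

  root∈labels : ∀ t → root t ∈ labels t
  root∈labels (node u ts) = here refl

  -- The root is preserved because the link entering a subtree from above names it.
  graft : ∀ {p} v t → p ∈ labels t → ∃ λ t′ → root t′ ≡ root t × links t′ ↭ (p , v) ∷ links t
  grafts : ∀ {p} v u ts → p ∈ labelss ts → ∃ λ ts′ → linkss u ts′ ↭ (p , v) ∷ linkss u ts
  graft v (node u ts) (here refl) = node u (node v [] ∷ ts) , refl , ↭-refl
  graft v (node u ts) (there p∈) = let ts′ , perm = grafts v u ts p∈ in node u ts′ , refl , perm
  grafts v u (t ∷ ts) p∈ with ∈-++⁻ (labels t) p∈
  ... | inj₁ p∈t with t′ , eq , perm ← graft v t p∈t rewrite sym eq =
    t′ ∷ ts , ↭-trans (↭-prep _ (++⁺ʳ (linkss u ts) perm)) (↭-swap _ _ ↭-refl)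
  ... | inj₂ p∈ts with ts′ , perm ← grafts v u ts p∈ts =
    t ∷ ts′ , ↭-trans (↭-prep _ (↭-trans (++⁺ˡ (links t) perm) (shift _ (links t) (linkss u ts)))) (↭-swap _ _ ↭-refl)

-- Rooted spanning trees of connected acyclic graphs.

module Growth {n : ℕ} (G : SimpleGraph n) where
  open SimpleGraph G renaming (sym to adj-sym)

  V : Set
  V = Fin n

  open import Data.List.Membership.DecPropositional (_≟_ {n}) using (_∈?_)

  flip : ∀ {u v} → Adj G u v → Adj G v u
  flip {u} {v} uv = trans (adj-sym v u) uv

  loopless : ∀ {v} → ¬ Adj G v v
  loopless {v} vv = case trans (sym vv) (irrefl v) of λ ()

  data Path : V → V → List V → Set where
    trivial : ∀ {a} → Path a a [ a ]
    cons    : ∀ {a b c xs} → Adj G a b → a ∉ xs → Path b c xs → Path a c (a ∷ xs)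

  snoc : ∀ {a b c xs} → Path a b xs → Adj G b c → c ∉ xs → Path a c (xs ++ [ c ])
  snoc trivial bc c∉ = cons bc (λ { (here refl) → c∉ (here refl) }) trivial
  snoc (cons {a} {xs = xs} ab a∉ p) bc c∉ = cons ab
    (λ a∈ → [ a∉ , (λ { (here refl) → c∉ (here refl) }) ]′ (∈-++⁻ xs a∈)) (snoc p bc (c∉ ∘ there))

  path-unique : ∀ {a b xs} → Path a b xs → Unique xs
  path-unique trivial = [] ∷ []
  path-unique (cons _ a∉ p) = All.tabulate (λ { x∈ refl → a∉ x∈ }) ∷ path-unique p

  path-linked : ∀ {v a b xs} → Adj G v a → Path a b xs → Linked (Adj G) (v ∷ xs)
  path-linked va trivial       = va ∷ [-]
  path-linked va (cons ab _ p) = va ∷ path-linked ab p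

  path-end : ∀ {a b xs} → Path a b xs → ∃ λ ys → xs ≡ ys ++ [ b ]
  path-end trivial = [] , refl
  path-end (cons {a} _ _ p) = let ys , eq = path-end p in a ∷ ys , cong (a ∷_) eq

  -- `a ≢ b` excludes the walk to a neighbour and back, which has only two vertices.
  close-cycle : ∀ {v a b xs} → Path a b xs → a ≢ b → v ∉ xs → Adj G v a → Adj G b v → Cycle G
  close-cycle trivial a≢b _ _ _ = contradiction refl a≢b
  close-cycle {v} {a} {b} p@(cons _ _ q) _ v∉ va bv with ys , refl ← path-end q =
    v , a , ys , b , (All.tabulate (λ { x∈ refl → v∉ x∈ }) ∷ path-unique p) , path-linked va p , bv

  -- `closed` ensures that no edge of the graph is missed by the links; `path` provides the cycle
  -- that proves it when a vertex is added.
  record Spans (t : Tree V) : Set where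
    field
      uniq   : Unique (labels t)
      adj    : ∀ {u v} → (u , v) ∈ links t → Adj G u v
      source : ∀ {u v} → (u , v) ∈ links t → u ∈ labels t
      closed : ∀ {u v} → u ∈ labels t → v ∈ labels t → Adj G u v → (u , v) ∈ links t ⊎ (v , u) ∈ links t
      asym   : ∀ {u v} → (u , v) ∈ links t → (v , u) ∉ links t
      path   : ∀ {u v} → u ∈ labels t → v ∈ labels t → ∃ λ xs → Path u v xs × All (_∈ labels t) xs

  singleton : ∀ r → Spans (node r [])
  singleton r = record
    { uniq = [] ∷ [] ; adj = λ () ; source = λ ()
    ; closed = λ { (here refl) (here refl) rr → contradiction rr loopless }
    ; asym = λ ()
    ; path = λ { (here refl) (here refl) → [ r ] , trivial , here refl ∷ [] } }

  module _ (acyclic : Acyclic G) where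

    -- A second neighbour of `v` in the tree would be joined to `p` inside the tree and close a
    -- cycle through `v`; hence the link from `p` is the only new edge.
    attach : ∀ {t p v} → Spans t → p ∈ labels t → v ∉ labels t → Adj G p v →
      ∃ λ t′ → Spans t′ × labels t′ ↭ v ∷ labels t
    attach {t} {p} {v} S p∈ v∉ pv with t′ , root≡ , perm ← graft v t p∈ = t′ , spans , lperm
      where
      open Spans S renaming (adj to adj₀; source to source₀; closed to closed₀; asym to asym₀; path to path₀)
      lperm : labels t′ ↭ v ∷ labels t
      lperm = ↭-trans (↭-reflexive (trans (labels≡root∷targets t′) (cong (_∷ map proj₂ (links t′)) root≡)))
        (↭-trans (↭-prep _ (map⁺ proj₂ perm))
        (↭-trans (↭-swap _ _ ↭-refl) (↭-prep v (↭-reflexive (sym (labels≡root∷targets t))))))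
      old : ∀ {u} → u ∈ labels t → u ∈ labels t′
      old = ∈-resp-↭ (↭-sym lperm) ∘ there
      new : ∀ {u} → u ∈ labels t′ → u ∈ v ∷ labels t
      new = ∈-resp-↭ lperm
      v∈ : v ∈ labels t′
      v∈ = ∈-resp-↭ (↭-sym lperm) (here refl)
      link : ∀ {e} → e ∈ (p , v) ∷ links t → e ∈ links t′
      link = ∈-resp-↭ (↭-sym perm)
      link⁻ : ∀ {e} → e ∈ links t′ → e ∈ (p , v) ∷ links t
      link⁻ = ∈-resp-↭ perm
      only-parent : ∀ {u} → u ∈ labels t → Adj G u v → u ≡ p
      only-parent {u} u∈ uv with u ≟ p
      ... | yes u≡p = u≡p
      ... | no u≢p with xs , P , xs⊆ ← path₀ p∈ u∈ =
        contradiction (close-cycle P (u≢p ∘ sym) (v∉ ∘ All.lookup xs⊆) (flip pv) uv) acyclic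
      spans : Spans t′
      spans = record
        { uniq = Permutation.Unique-resp-↭ (setoid V) (↭⇒↭ₛ (↭-sym lperm)) (All.tabulate (λ { x∈ refl → v∉ x∈ }) ∷ uniq)
        ; adj = λ e → case link⁻ e of λ { (here refl) → pv ; (there e) → adj₀ e }
        ; source = λ e → case link⁻ e of λ { (here refl) → old p∈ ; (there e) → old (source₀ e) }
        ; closed = closed
        ; asym = asym
        ; path = path }
        where
        closed : ∀ {u w} → u ∈ labels t′ → w ∈ labels t′ → Adj G u w → (u , w) ∈ links t′ ⊎ (w , u) ∈ links t′
        closed u∈ w∈ uw with new u∈ | new w∈
        ... | here refl | here refl = contradiction uw loopless
        ... | here refl | there w∈ with refl ← only-parent w∈ (flip uw) = inj₂ (link (here refl))
        ... | there u∈ | here refl with refl ← only-parent u∈ uw = inj₁ (link (here refl))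
        ... | there u∈ | there w∈ = [ inj₁ ∘ link ∘ there , inj₂ ∘ link ∘ there ]′ (closed₀ u∈ w∈ uw)
        asym : ∀ {u w} → (u , w) ∈ links t′ → (w , u) ∉ links t′
        asym uw wu with link⁻ uw | link⁻ wu
        ... | here refl | here refl = loopless pv
        ... | here refl | there wu = v∉ (source₀ wu)
        ... | there uw | here refl = v∉ (source₀ uw)
        ... | there uw | there wu = asym₀ uw wu
        path : ∀ {u w} → u ∈ labels t′ → w ∈ labels t′ → ∃ λ xs → Path u w xs × All (_∈ labels t′) xs
        path u∈ w∈ with new u∈ | new w∈
        ... | here refl | here refl = [ v ] , trivial , v∈ ∷ []
        ... | here refl | there w∈ with xs , P , xs⊆ ← path₀ p∈ w∈ =
          v ∷ xs , cons (flip pv) (v∉ ∘ All.lookup xs⊆) P , v∈ ∷ All.map old xs⊆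
        ... | there u∈ | here refl with xs , P , xs⊆ ← path₀ u∈ p∈ =
          xs ++ [ v ] , snoc P pv (v∉ ∘ All.lookup xs⊆) , All.++⁺ (All.map old xs⊆) (v∈ ∷ [])
        ... | there u∈ | there w∈ with xs , P , xs⊆ ← path₀ u∈ w∈ = xs , P , All.map old xs⊆

    grow : ∀ {t u x} → Spans t → u ∈ labels t → Reach G u x →
      ∃ λ t′ → Spans t′ × (∀ {w} → w ∈ labels t → w ∈ labels t′) × x ∈ labels t′
    grow {t} S u∈ here = t , S , id , u∈
    grow {t} S u∈ (step {w = w} uw r) with w ∈? labels t
    ... | yes w∈ = grow S w∈ r
    ... | no w∉ with t₁ , S₁ , perm ← attach S u∈ w∉ uw
                with t₂ , S₂ , ⊆₂ , x∈ ← grow S₁ (∈-resp-↭ (↭-sym perm) (here refl)) r =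
      t₂ , S₂ , ⊆₂ ∘ ∈-resp-↭ (↭-sym perm) ∘ there , x∈

    cover : Connected G → V → ∀ vs → ∃ λ t → Spans t × (∀ {v} → v ∈ vs → v ∈ labels t)
    cover conn r [] = node r [] , singleton r , λ ()
    cover conn r (v ∷ vs) with t , S , vs⊆ ← cover conn r vs
                          with t′ , S′ , ⊆′ , v∈ ← grow S (root∈labels t) (conn (root t) v) =
      t′ , S′ , λ { (here refl) → v∈ ; (there w∈) → ⊆′ (vs⊆ w∈) }

    spanning-tree : Connected G → V → ∃ λ t → Spans t × (∀ v → v ∈ labels t)
    spanning-tree conn r with t , S , all ← cover conn r (allFin n) = t , S , λ v → all (∈-allFin v)

-- Association lists, pairwise relations and the degree bound.

module _ {K X : Set} (_≟ₖ_ : DecidableEquality K) where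

  assoc : List (K × X) → K → Maybe X
  assoc [] k = nothing
  assoc ((k′ , x) ∷ es) k with k ≟ₖ k′
  ... | yes _ = just x
  ... | no _  = assoc es k

  assoc-sound : ∀ es {k x} → assoc es k ≡ just x → (k , x) ∈ es
  assoc-sound ((k′ , x) ∷ es) {k} eq with k ≟ₖ k′
  assoc-sound ((k′ , x) ∷ es) refl | yes refl = here refl
  ... | no _ = there (assoc-sound es eq)

  assoc-complete : ∀ {es k x} → Unique (map proj₁ es) → (k , x) ∈ es → assoc es k ≡ just x
  assoc-complete {(k′ , _) ∷ es} {k} (k′∉ ∷ u) k∈ with k ≟ₖ k′ | k∈
  ... | yes refl | here refl = refl
  ... | yes refl | there k∈ = contradiction refl (All.lookup k′∉ (∈-map⁺ proj₁ k∈))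
  ... | no k≢k′ | here refl = contradiction refl k≢k′
  ... | no _ | there k∈ = assoc-complete u k∈

module _ {A : Set} {R : A → A → Set} where

  allPairs-lookup : ∀ {xs x y} → AllPairs R xs → x ∈ xs → y ∈ xs → x ≡ y ⊎ R x y ⊎ R y x
  allPairs-lookup (_ ∷ _) (here refl) (here refl) = inj₁ refl
  allPairs-lookup (rs ∷ _) (here refl) (there y∈) = inj₂ (inj₁ (All.lookup rs y∈))
  allPairs-lookup (rs ∷ _) (there x∈) (here refl) = inj₂ (inj₂ (All.lookup rs x∈))
  allPairs-lookup (_ ∷ rss) (there x∈) (there y∈) = allPairs-lookup rss x∈ y∈

  allPairs-resp-⊆ : ∀ {xs ys} → xs ⊆ ys → AllPairs R ys → AllPairs R xs
  allPairs-resp-⊆ [] [] = []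
  allPairs-resp-⊆ (_ ∷ʳ sub) (_ ∷ rss) = allPairs-resp-⊆ sub rss
  allPairs-resp-⊆ (refl ∷ sub) (rs ∷ rss) = Sublist.All-resp-⊆ sub rs ∷ allPairs-resp-⊆ sub rss

unique-map⁻ : ∀ {A B : Set} {f : A → B} {xs x y} → Unique (map f xs) → x ∈ xs → y ∈ xs → f x ≡ f y → x ≡ y
unique-map⁻ u x∈ y∈ eq with allPairs-lookup (AllPairs.map⁻ u) x∈ y∈
... | inj₁ x≡y = x≡y
... | inj₂ (inj₁ ne) = contradiction eq ne
... | inj₂ (inj₂ ne) = contradiction (sym eq) ne

module _ {n : ℕ} (G : SimpleGraph n) where

  ≤-maximum : ∀ {m ms} → m ∈ ms → m ≤ foldr _⊔_ 0 ms
  ≤-maximum {ms = m ∷ ms} (here refl) = m≤m⊔n m _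
  ≤-maximum {ms = m ∷ ms} (there m∈)  = ≤-trans (≤-maximum m∈) (m≤n⊔m m _)

  neighbours≤maxDegree : ∀ {u ws} → Unique ws → All (Adj G u) ws → length ws ≤ maxDegree G
  neighbours≤maxDegree {u} uniq adjs = ≤-trans
    (unique-⊆⇒length≤ uniq λ {w} w∈ → ∈-filter⁺ (λ v → T? (SimpleGraph.adj G u v)) (∈-allFin w)
      (subst T (sym (All.lookup adjs w∈)) _))
    (≤-maximum (∈-map⁺ (degree G) (∈-allFin u)))

-- The cost of a tree as a number of precoloured slots.

module _ (D : ℕ) {V : Set} (pre : Slot V → Maybe (Fin (suc D))) where
  open Rooted D pre

  occupied : List (Slot V) → ℕ
  occupied ss = length (catMaybes (map pre ss))

  occupied-∷ : ∀ s ss → occupied (s ∷ ss) ≡ # (pre s) + occupied ss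
  occupied-∷ s ss = length-catMaybes-∷ (pre s) (map pre ss)

  occupied-++ : ∀ ss ss′ → occupied (ss ++ ss′) ≡ occupied ss + occupied ss′
  occupied-++ ss ss′ = trans (cong (length ∘ catMaybes) (map-++ pre ss ss′))
    (trans (cong length (catMaybes-++ (map pre ss) (map pre ss′))) (length-++ (catMaybes (map pre ss))))

  slotsOf : List V → List (Slot V)
  slotsOf vs = cartesianProduct vs (just false ∷ just true ∷ nothing ∷ [])

  slotsOf-++ : ∀ vs ws → slotsOf (vs ++ ws) ≡ slotsOf vs ++ slotsOf ws
  slotsOf-++ [] ws = refl
  slotsOf-++ (v ∷ vs) ws = cong (λ ss → _ ∷ _ ∷ _ ∷ ss) (slotsOf-++ vs ws)

  -- With the pair above the root included, every vertex owns exactly three slots and the recursion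
  -- is uniform.
  cost≡occupied : ∀ t → # (π false t) + # (π true t) + cost t ≡ occupied (slotsOf (labels t))
  costs≡occupied : ∀ ts → costs ts ≡ occupied (slotsOf (labelss ts))
  cost≡occupied t@(node u ts) = begin
    # (π false t) + # (π true t) + (# (ρ t) + costs ts)   ≡⟨ cong (λ c → # (π false t) + # (π true t) + (# (ρ t) + c)) (costs≡occupied ts) ⟩
    # (π false t) + # (π true t) + (# (ρ t) + o)          ≡⟨ +-assoc (# (π false t)) _ _ ⟩
    # (π false t) + (# (π true t) + (# (ρ t) + o))        ≡⟨ cong (λ c → # (π false t) + (# (π true t) + c)) (occupied-∷ (u , nothing) ss) ⟨
    # (π false t) + (# (π true t) + occupied ((u , nothing) ∷ slotsOf (labelss ts))) ≡⟨ cong (# (π false t) +_) (occupied-∷ (u , just true) ((u , nothing) ∷ ss)) ⟨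
    # (π false t) + occupied ((u , just true) ∷ (u , nothing) ∷ ss) ≡⟨ occupied-∷ (u , just false) ((u , just true) ∷ (u , nothing) ∷ ss) ⟨
    occupied (slotsOf (labels t)) ∎
    where
    open ≡-Reasoning
    ss = slotsOf (labelss ts)
    o = occupied ss
  costs≡occupied [] = refl
  costs≡occupied (t ∷ ts) = trans (cong₂ _+_ (cost≡occupied t) (costs≡occupied ts))
    (trans (sym (occupied-++ (slotsOf (labels t)) _)) (cong occupied (sym (slotsOf-++ (labels t) (labelss ts)))))

  occupied-sublist : ∀ ss → ∃ λ ss′ → ss′ ⊆ ss × length ss′ ≡ occupied ss × All (λ s → ∃ λ c → pre s ≡ just c) ss′
  occupied-sublist [] = [] , [] , refl , []
  occupied-sublist (s ∷ ss) with pre s in eq | occupied-sublist ss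
  ... | just c  | ss′ , sub , len , all = s ∷ ss′ , refl ∷ sub , cong suc len , (c , eq) ∷ all
  ... | nothing | ss′ , sub , len , all = ss′ , s ∷ʳ sub , len , all

  occupied≤ : ∀ {ss ks} → Unique ss → (∀ {s c} → pre s ≡ just c → s ∈ ks) → occupied ss ≤ length ks
  occupied≤ {ss} u dom with ss′ , sub , len , all ← occupied-sublist ss =
    subst (_≤ _) len (unique-⊆⇒length≤ (allPairs-resp-⊆ sub u) (λ s∈ → dom (proj₂ (All.lookup all s∈))))

  cost≤ : ∀ {t ks} → Unique (labels t) → (∀ {s c} → pre s ≡ just c → s ∈ ks) → cost t ≤ length ks
  cost≤ {t} u dom = ≤-trans (m≤n+m (cost t) (# (π false t) + # (π true t)))
    (≤-trans (≤-reflexive (cost≡occupied t)) (occupied≤ (cartesianProduct⁺ u distinct) dom))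
    where
    distinct : Unique (just false ∷ just true ∷ nothing ∷ [])
    distinct = ((λ ()) ∷ (λ ()) ∷ []) ∷ ((λ ()) ∷ []) ∷ [] ∷ []

-- Edges of the product as slots of the rooted tree.

module Ladder {n : ℕ} (G : SimpleGraph n) where
  open Growth G

  module Layout {t : Tree V} (S : Spans t) (all : ∀ v → v ∈ labels t) where
    open Spans S

    parent : V → Maybe V
    parent = assoc _≟_ (map swap (links t))

    parent-sound : ∀ {u v} → parent v ≡ just u → (u , v) ∈ links t
    parent-sound eq with (_ , _) , e , refl ← ∈-map⁻ swap (assoc-sound _≟_ (map swap (links t)) eq) = e

    targets-unique : Unique (map proj₂ (links t))
    targets-unique = AllPairs.tail (subst Unique (labels≡root∷targets t) uniq)

    parent-complete : ∀ {u v} → (u , v) ∈ links t → parent v ≡ just u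
    parent-complete e = assoc-complete _≟_ (subst Unique (map-∘ (links t)) targets-unique) (∈-map⁺ swap e)

    parent-root : parent (root t) ≡ nothing
    parent-root with parent (root t) in eq
    ... | nothing = refl
    ... | just u = contradiction refl (All.lookup (AllPairs.head (subst Unique (labels≡root∷targets t) uniq))
                     (∈-map⁺ proj₂ (parent-sound eq)))

    parent-asym : ∀ {u v} → parent v ≡ just u → parent u ≢ just v
    parent-asym e e′ = asym (parent-sound e) (parent-sound e′)

    -- The last case is meant for the step from `u` to its parent; for pairs that are not adjacent
    -- it is an arbitrary default.
    slot : V × Bool → V × Bool → Slot V
    slot (u , i) (v , j) with u ≟ v | Maybe.≡-dec _≟_ (parent v) (just u)
    ... | yes _ | _     = u , nothing
    ... | no _  | yes _ = v , just i
    ... | no _  | no _  = u , just i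

    data Edge : V × Bool → V × Bool → Slot V → Set where
      rung : ∀ {u i j} → i ≢ j → Edge (u , i) (u , j) (u , nothing)
      down : ∀ {u v i} → parent v ≡ just u → Edge (u , i) (v , i) (v , just i)
      up   : ∀ {u v i} → parent u ≡ just v → Edge (u , i) (v , i) (u , just i)

    edge : ∀ {x y} → □K₂Adj G x y → Edge x y (slot x y)
    edge {u , i} {v , j} e with u ≟ v | Maybe.≡-dec _≟_ (parent v) (just u) | e
    ... | yes refl | _ | inj₁ (uu , _) = contradiction uu loopless
    ... | yes refl | _ | inj₂ (_ , i≢j) = rung i≢j
    ... | no u≢v | _ | inj₂ (u≡v , _) = contradiction u≡v u≢v
    ... | no _ | yes pv | inj₁ (_ , refl) = down pv
    ... | no _ | no ¬pv | inj₁ (uv , refl) with closed (all u) (all v) uv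
    ... | inj₁ l = contradiction (parent-complete l) ¬pv
    ... | inj₂ l = up (parent-complete l)

    edge-sym : ∀ {x y s} → Edge x y s → Edge y x s
    edge-sym (rung i≢j) = rung (i≢j ∘ sym)
    edge-sym (down p)   = up p
    edge-sym (up p)     = down p

    edge-functional : ∀ {x y s s′} → Edge x y s → Edge x y s′ → s ≡ s′
    edge-functional (rung _) (rung _) = refl
    edge-functional (rung i≢i) (down _) = contradiction refl i≢i
    edge-functional (rung i≢i) (up _) = contradiction refl i≢i
    edge-functional (down _) (rung i≢i) = contradiction refl i≢i
    edge-functional (down _) (down _) = refl
    edge-functional (down p) (up p′) = contradiction p′ (parent-asym p)
    edge-functional (up _) (rung i≢i) = contradiction refl i≢i
    edge-functional (up p) (down p′) = contradiction p′ (parent-asym p)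
    edge-functional (up _) (up _) = refl

    -- The parent equations rule out the two slots above the root, which stand for no edge.
    data Touches : Slot V → V × Bool → Set where
      rung  : ∀ {v i} → Touches (v , nothing) (v , i)
      lower : ∀ {u v i} → parent v ≡ just u → Touches (v , just i) (v , i)
      upper : ∀ {u v i} → parent v ≡ just u → Touches (v , just i) (u , i)

    touch : ∀ {x y s} → Edge x y s → Touches s x
    touch (rung _) = rung
    touch (down p) = upper p
    touch (up p)   = lower p

    different-bits : ∀ {i j k : Bool} → i ≢ j → k ≡ i ⊎ k ≡ j
    different-bits {false} {false} i≢j = contradiction refl i≢j
    different-bits {false} {true} {false} _ = inj₁ refl
    different-bits {false} {true} {true} _ = inj₂ refl
    different-bits {true} {false} {false} _ = inj₂ refl
    different-bits {true} {false} {true} _ = inj₁ refl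
    different-bits {true} {true} i≢j = contradiction refl i≢j

    touches⇒end : ∀ {x y s z} → Edge x y s → Touches s z → z ≡ x ⊎ z ≡ y
    touches⇒end {z = _ , k} (rung i≢j) rung with different-bits {k = k} i≢j
    ... | inj₁ refl = inj₁ refl
    ... | inj₂ refl = inj₂ refl
    touches⇒end (down _) (lower _) = inj₂ refl
    touches⇒end (down p) (upper p′) with refl ← just-injective (trans (sym p) p′) = inj₁ refl
    touches⇒end (up _) (lower _) = inj₁ refl
    touches⇒end (up p) (upper p′) with refl ← just-injective (trans (sym p) p′) = inj₂ refl

    edge-ends≢ : ∀ {x y s} → Edge x y s → x ≢ y
    edge-ends≢ (rung i≢i) refl = i≢i refl
    edge-ends≢ (down p) refl = parent-asym p p
    edge-ends≢ (up p) refl = parent-asym p p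

    edge-injective : ∀ {x y x′ y′ s} → Edge x y s → Edge x′ y′ s → (x ≡ x′ × y ≡ y′) ⊎ (x ≡ y′ × y ≡ x′)
    edge-injective e e′ with touches⇒end e′ (touch e) | touches⇒end e′ (touch (edge-sym e))
    ... | inj₁ refl | inj₁ refl = contradiction refl (edge-ends≢ e)
    ... | inj₁ refl | inj₂ refl = inj₁ (refl , refl)
    ... | inj₂ refl | inj₁ refl = inj₂ (refl , refl)
    ... | inj₂ refl | inj₂ refl = contradiction refl (edge-ends≢ e)

    slot-sym : ∀ {x y} → □K₂Adj G x y → □K₂Adj G y x → slot x y ≡ slot y x
    slot-sym e e′ = edge-functional (edge e) (edge-sym (edge e′))

    roots⊆ : (ts : List (Tree V)) → map root ts ⊆ labelss ts
    roots⊆ [] = []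
    roots⊆ (node v us ∷ ts) = refl ∷ Sublist.++⁺ˡ (labelss us) (roots⊆ ts)

    unique-children : ∀ {u ts} → Unique (u ∷ labelss ts) → Unique (u ∷ map root ts)
    unique-children {ts = ts} = allPairs-resp-⊆ (refl ∷ roots⊆ ts)

    -- Tameness of the rooted precolouring, and the edge colouring read off from a coloured tree.

    module Precoloured (D : ℕ) (D-max : maxDegree G ≤ D) (pre : Slot V → Maybe (Fin (suc D)))
      (pre-apart : ∀ {z s s′} → Touches s z → Touches s′ z → s ≢ s′ → Apart (pre s) (pre s′)) where
      open Rooted D pre

      child-link : ∀ {u : V} {ts t′} → t′ ∈ ts → (u , root t′) ∈ linkss u ts
      child-link {ts = t′ ∷ ts} (here refl) = here refl
      child-link {ts = t₁ ∷ ts} (there t′∈) = there (∈-++⁺ʳ (links t₁) (child-link t′∈))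

      star-apart : ∀ u ts → Unique (u ∷ labelss ts) → (∀ {e} → e ∈ linkss u ts → e ∈ links t) →
        ∀ i → AllPairs Apart (star i (node u ts))
      star-apart u ts uniq sub i =
        All.map⁺ (All.tabulate λ t′∈ → pre-apart {u , i} rung (upper (par t′∈)) (λ ()))
        ∷ AllPairs.map⁺ (siblings (λ t′∈ → t′∈) (AllPairs.map⁻ (AllPairs.tail (unique-children uniq))))
        where
        par : ∀ {t′} → t′ ∈ ts → parent (root t′) ≡ just u
        par t′∈ = parent-complete (sub (child-link t′∈))
        siblings : ∀ {us} → (∀ {t′} → t′ ∈ us → t′ ∈ ts) → AllPairs (λ a b → root a ≢ root b) us →
          AllPairs (λ a b → Apart (π i a) (π i b)) us
        siblings us⊆ [] = []
        siblings us⊆ (ne ∷ nes) =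
          All.tabulate (λ b∈ → pre-apart (upper (par (us⊆ (here refl)))) (upper (par (us⊆ (there b∈))))
            (λ eq → All.lookup ne b∈ (cong proj₁ eq)))
          ∷ siblings (us⊆ ∘ there) nes

      up-apart : ∀ t₀ {p} → parent (root t₀) ≡ just p → Unique (labels t₀) → (∀ {e} → e ∈ links t₀ → e ∈ links t) →
        ∀ i → All (Apart (π i t₀)) (star i t₀)
      up-apart (node w us) pw uniq sub i =
        pre-apart (lower pw) rung (λ ())
        ∷ All.map⁺ (All.tabulate λ t′∈ → pre-apart (lower pw) (upper (parent-complete (sub (child-link t′∈))))
            (λ eq → All.lookup (AllPairs.head (unique-children uniq)) (∈-map⁺ root t′∈) (cong proj₁ eq)))

      -- `ps` is the parent, if there is one; together with the children it consists of distinct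
      -- neighbours of the root, so the degree bounds their number.
      tame-at : ∀ ps t₀ → Unique (ps ++ labels t₀) → All (Adj G (root t₀)) ps →
        (∀ {e} → e ∈ links t₀ → e ∈ links t) → Tame (length ps) t₀
      tames : ∀ u us → Unique (u ∷ labelss us) → (∀ {e} → e ∈ linkss u us → e ∈ links t) →
        All (λ t′ → (∀ i → All (Apart (π i t′)) (star i t′)) × Tame 1 t′) us
      tame-at ps (node u ts) uniq adjs sub = tame
        (≤-trans (≤-reflexive (trans (cong (length ps +_) (sym (length-map root ts))) (sym (length-++ ps))))
          (≤-trans (neighbours≤maxDegree G (allPairs-resp-⊆ (Sublist.++⁺ (⊆-refl {x = ps}) (u ∷ʳ roots⊆ ts)) uniq)
             (All.++⁺ adjs (All.map⁺ (All.tabulate λ t′∈ → adj (sub (child-link t′∈)))))) D-max))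
        (star-apart u ts uniq′ sub) (tames u ts uniq′ sub)
        where
        uniq′ : Unique (u ∷ labelss ts)
        uniq′ = allPairs-resp-⊆ (Sublist.++⁺ˡ ps ⊆-refl) uniq
      tames u [] _ _ = []
      tames u (t′ ∷ us) uniq sub =
        ( up-apart t′ (parent-complete (sub (here refl)))
            (allPairs-resp-⊆ (u ∷ʳ Sublist.++⁺ʳ (labelss us) ⊆-refl) uniq) (sub ∘ there ∘ ∈-++⁺ˡ)
        , tame-at [ u ] t′ (allPairs-resp-⊆ (refl ∷ Sublist.++⁺ʳ (labelss us) ⊆-refl) uniq)
            (flip (adj (sub (here refl))) ∷ []) (sub ∘ there ∘ ∈-++⁺ˡ) )
        ∷ tames u us (allPairs-resp-⊆ (refl ∷ Sublist.++⁺ˡ (labels t′) ⊆-refl) uniq)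
            (sub ∘ there ∘ ∈-++⁺ʳ (links t′))

      tame-root : Tame 0 t
      tame-root = tame-at [] t uniq [] id

      -- For a vertex: the pair of colours above it, its rung colour and its children. The children
      -- are stored so that the slots touching it can be matched with its star.
      Entry : Set
      Entry = V × (Colour × Colour) × Colour × List V

      ChildrenColoured : List (Tree V) → List (Colour × Colour) → Set
      ChildrenColoured = Pointwise (λ t′ β → Coloured [ β ] t′ × (∀ i → at i β Matches (π i t′)))

      entries : ∀ {αs t₀} → Colour × Colour → Coloured αs t₀ → List Entry
      entriess : ∀ {ts βs} → ChildrenColoured ts βs → List Entry
      entries α (coloured {u = u} {ts} r _ _ subs _) = (u , α , r , map root ts) ∷ entriess subs
      entriess [] = []
      entriess (_∷_ {y = β} (col , _) subs) = entries β col ++ entriess subs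

      entries-keys : ∀ {αs t₀} α (col : Coloured αs t₀) → map proj₁ (entries α col) ≡ labels t₀
      entriess-keys : ∀ {ts βs} (subs : ChildrenColoured ts βs) → map proj₁ (entriess subs) ≡ labelss ts
      entries-keys α (coloured r _ _ subs _) = cong (_ ∷_) (entriess-keys subs)
      entriess-keys [] = refl
      entriess-keys (_∷_ {y = β} (col , _) subs) = trans (map-++ proj₁ (entries β col) (entriess subs))
        (cong₂ _++_ (entries-keys β col) (entriess-keys subs))

      entry-links : ∀ {αs t₀ u w} α (col : Coloured αs t₀) → (u , w) ∈ links t₀ →
        ∃ λ β → ∃ λ r → ∃ λ ws → (u , β , r , ws) ∈ entries α col × w ∈ ws
      entriess-links : ∀ {ts βs v u w} (subs : ChildrenColoured ts βs) → (u , w) ∈ linkss v ts →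
        (u ≡ v × w ∈ map root ts) ⊎ ∃ λ β → ∃ λ r → ∃ λ ws → (u , β , r , ws) ∈ entriess subs × w ∈ ws
      entry-links α (coloured r _ _ subs _) e∈ with entriess-links subs e∈
      ... | inj₁ (refl , w∈) = α , r , _ , here refl , w∈
      ... | inj₂ (β , s , ws , ∈es , w∈) = β , s , ws , there ∈es , w∈
      entriess-links (_ ∷ _) (here refl) = inj₁ (refl , here refl)
      entriess-links (_∷_ {x = t′} {y = β} (col , _) subs) (there e∈) with ∈-++⁻ (links t′) e∈
      ... | inj₁ e∈t′ with γ , s , ws , ∈es , w∈ ← entry-links β col e∈t′ =
        inj₂ (γ , s , ws , ∈-++⁺ˡ ∈es , w∈)
      ... | inj₂ e∈ts with entriess-links subs e∈ts
      ... | inj₁ (eq , w∈) = inj₁ (eq , there w∈)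
      ... | inj₂ (γ , s , ws , ∈es , w∈) = inj₂ (γ , s , ws , ∈-++⁺ʳ (entries β col) ∈es , w∈)

      module Extraction (col : Coloured [] t) where

        table : List Entry
        -- A dummy pair, since nothing lies above the root.
        table = entries (Fin.zero , Fin.zero) col

        table-unique : Unique (map proj₁ table)
        table-unique = subst Unique (sym (entries-keys _ col)) uniq

        value : V → (Colour × Colour) × Colour × List V
        value v = Maybe.fromMaybe ((Fin.zero , Fin.zero) , Fin.zero , []) (assoc _≟_ table v)

        value≡ : ∀ {v x} → (v , x) ∈ table → value v ≡ x
        value≡ ∈t = cong (Maybe.fromMaybe _) (assoc-complete _≟_ table-unique ∈t)

        colour : Slot V → Colour
        colour (v , nothing) = proj₁ (proj₂ (value v))
        colour (v , just i)  = at i (proj₁ (value v))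

        children-colours : ∀ {ts βs} (subs : ChildrenColoured ts βs) → (∀ {e} → e ∈ entriess subs → e ∈ table) →
          ∀ i → map colour (map (λ w → (w , just i)) (map root ts)) ≡ map (at i) βs
        children-colours [] _ _ = refl
        children-colours (_∷_ {x = node w us} {y = β} (coloured r m γs below q , _) subs) ⊆table i =
          cong₂ _∷_ (cong (at i ∘ proj₁) (value≡ (⊆table (here refl))))
            (children-colours subs (⊆table ∘ ∈-++⁺ʳ (entries β (coloured {u = w} {us} r m γs below q))) i)

        record Settled (u : V) : Set where
          field
            proper : ∀ {i s s′} → Touches s (u , i) → Touches s′ (u , i) → s ≢ s′ → colour s ≢ colour s′
            rung-fits : colour (u , nothing) Matches (pre (u , nothing))
            up-fits : ∀ {p} → parent u ≡ just p → ∀ i → colour (u , just i) Matches (pre (u , just i))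

        -- Separates the root, whose stored pair is a dummy outside its star, from the other
        -- vertices, whose pair belongs to the star and respects the precolouring.
        data Context (t₀ : Tree V) (α : Colour × Colour) : List (Colour × Colour) → Set where
          top   : parent (root t₀) ≡ nothing → Context t₀ α []
          below : (∀ i → at i α Matches (π i t₀)) → Context t₀ α [ α ]

        settle : ∀ {αs t₀ α} → Context t₀ α αs → (c : Coloured αs t₀) → (∀ {e} → e ∈ entries α c → e ∈ table) →
          ∀ {v} → v ∈ labels t₀ → Settled v
        settles : ∀ {ts βs} (subs : ChildrenColoured ts βs) → (∀ {e} → e ∈ entriess subs → e ∈ table) →
          ∀ {v} → v ∈ labelss ts → Settled v
        settle ctx (coloured r m βs subs q) ⊆table (there v∈) = settles subs (⊆table ∘ there) v∈
        settle {αs} {_} {α} ctx (coloured {u = u} {ts} r m βs subs q) ⊆table (here refl) = record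
          -- `q` makes the colours of the listed star slots pairwise distinct, and every slot
          -- touching the vertex is listed, so equal colours force equal slots.
          { proper = λ {i} a b ne eq → ne (unique-map⁻ (subst Unique (sym (star-colours i ctx)) (q i)) (star-complete ctx a) (star-complete ctx b) eq)
          ; rung-fits = λ e → trans (cong (proj₁ ∘ proj₂) here≡) (m e)
          ; up-fits = up-fits ctx }
          where
          here≡ : value u ≡ (α , r , map root ts)
          here≡ = value≡ (⊆table (here refl))
          ups : ∀ {αs} → Bool → Context (node u ts) α αs → List (Slot V)
          ups i (top _)   = []
          ups i (below _) = [ (u , just i) ]
          starSlots : ∀ {αs} → Bool → Context (node u ts) α αs → List (Slot V)
          starSlots i ctx = (u , nothing) ∷ ups i ctx ++ map (λ w → (w , just i)) (map root ts)
          star-colours : ∀ {αs} i (ctx : Context (node u ts) α αs) → map colour (starSlots i ctx) ≡ r ∷ map (at i) (αs ++ βs)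
          star-colours i (top _) = cong₂ _∷_ (cong (proj₁ ∘ proj₂) here≡) (children-colours subs (⊆table ∘ there) i)
          star-colours i (below _) = cong₂ _∷_ (cong (proj₁ ∘ proj₂) here≡)
            (cong₂ _∷_ (cong (at i ∘ proj₁) here≡) (children-colours subs (⊆table ∘ there) i))
          child∈ : ∀ {w} → parent w ≡ just u → w ∈ map root ts
          -- Each vertex has a single entry in the table, so the children found there are those of
          -- `u`.
          child∈ pw with β , s , ws , ∈es , w∈ ← entry-links _ col (parent-sound pw) =
            subst (_ ∈_) (cong (proj₂ ∘ proj₂) (trans (sym (value≡ ∈es)) here≡)) w∈
          star-complete : ∀ {αs i s} (ctx : Context (node u ts) α αs) → Touches s (u , i) → s ∈ starSlots i ctx
          star-complete ctx rung = here refl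
          star-complete (top p) (lower pu) = case trans (sym p) pu of λ ()
          star-complete (below _) (lower pu) = there (here refl)
          star-complete {i = i} ctx (upper pw) = there (∈-++⁺ʳ (ups i ctx) (∈-map⁺ (λ w → (w , just i)) (child∈ pw)))
          up-fits : ∀ {αs} → Context (node u ts) α αs → ∀ {p} → parent u ≡ just p → ∀ i → colour (u , just i) Matches (pre (u , just i))
          up-fits (top e) pu = case trans (sym e) pu of λ ()
          up-fits (below fit) pu i e = trans (cong (at i ∘ proj₁) here≡) (fit i e)
        settles (_∷_ {x = t′} {y = β} (c , fit) subs) ⊆table v∈ with ∈-++⁻ (labels t′) v∈
        ... | inj₁ v∈t′ = settle (below fit) c (⊆table ∘ ∈-++⁺ˡ) v∈t′
        ... | inj₂ v∈ts = settles subs (⊆table ∘ ∈-++⁺ʳ (entries β c)) v∈ts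

        settled : ∀ v → Settled v
        settled v = settle (top parent-root) col id (all v)

        colour-proper : ∀ {z s s′} → Touches s z → Touches s′ z → s ≢ s′ → colour s ≢ colour s′
        colour-proper {u , _} = Settled.proper (settled u)

        colour-fits : ∀ {z s} → Touches s z → colour s Matches (pre s)
        colour-fits {s = v , _} rung = Settled.rung-fits (settled v)
        colour-fits {s = v , _} (lower p) = Settled.up-fits (settled v) p _
        colour-fits {s = v , _} (upper p) = Settled.up-fits (settled v) p _

-- Colours numbered from 1, and the extension for `2 ≤ D`.

toColour : ∀ D → ℕ → Fin (suc D)
toColour D c = (c ∸ 1) mod suc D

-- Within the admissible range the reduction modulo `suc D` never wraps around.
toColour-correct : ∀ {D c} → 1 ≤ c → c ≤ suc D → suc (toℕ (toColour D c)) ≡ c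
toColour-correct {D} {suc c} _ c<k = cong suc (trans (toℕ-fromℕ< _) (m<n⇒m%n≡m c<k))

toColour-injective : ∀ {D c d} → 1 ≤ c → c ≤ suc D → 1 ≤ d → d ≤ suc D → toColour D c ≡ toColour D d → c ≡ d
toColour-injective 1≤c c≤k 1≤d d≤k eq =
  trans (sym (toColour-correct 1≤c c≤k)) (trans (cong (suc ∘ toℕ) eq) (toColour-correct 1≤d d≤k))

module _ {n : ℕ} (T : SimpleGraph n) where
  open Growth T using (V; Spans; flip; loopless)
  open Ladder T

  E : V × Bool → V × Bool → Set
  E = □K₂Adj T

  Extension : ℕ → List (PreEdge E) → Set
  Extension k φ = Σ (V × Bool → V × Bool → ℕ) λ f → ProperEdgeColouring E k f × Extends E f φ

  E-sym : ∀ {x y} → E x y → E y x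
  E-sym (inj₁ (uv , i≡j)) = inj₁ (flip uv , sym i≡j)
  E-sym (inj₂ (u≡v , i≢j)) = inj₂ (sym u≡v , i≢j ∘ sym)

  extend-spanned : ∀ {t} D → Spans t → (∀ v → v ∈ labels t) → maxDegree T ≤ D → 2 ≤ D →
    ∀ φ → IsPrecolouring E (suc D) φ → length φ ≤ D → Extension (suc D) φ
  extend-spanned {t} D S all Δ≤D 2≤D φ (valid , compatible) few = f , (symmetric , range , proper) , extends
    where
    open Layout S all

    _≟ₛ_ : DecidableEquality (Slot V)
    _≟ₛ_ = Product.≡-dec _≟_ (Maybe.≡-dec Bool._≟_)

    key : PreEdge E → Slot V × Fin (suc D)
    key (x , y , c) = slot x y , toColour D c

    -- A slot determines its edge up to orientation, so a repeated key would be a repeated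
    -- precoloured edge; hence lookup recovers every entry of `φ`.
    keys-unique : ∀ {φ} → All (λ { (x , y , c) → E x y × 1 ≤ c × c ≤ suc D }) φ → AllPairs (Compatible E) φ →
      Unique (map proj₁ (map key φ))
    keys-unique [] [] = []
    keys-unique ((e , _) ∷ es) (comp ∷ comps) =
      All.map⁺ (All.map⁺ (All.zipWith (λ { ((e′ , _) , (different , _)) eq →
        different (edge-injective (edge e) (subst (Edge _ _) (sym eq) (edge e′))) }) (es , comp)))
      ∷ keys-unique es comps

    pre : Slot V → Maybe (Fin (suc D))
    pre = assoc _≟ₛ_ (map key φ)

    pre-sound : ∀ {s k} → pre s ≡ just k → ∃ λ x → ∃ λ y → ∃ λ c → (x , y , c) ∈ φ × s ≡ slot x y × k ≡ toColour D c
    pre-sound eq with (x , y , c) , ∈φ , refl ← ∈-map⁻ key (assoc-sound _≟ₛ_ (map key φ) eq) = x , y , c , ∈φ , refl , refl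

    clash : ∀ {x y c x′ y′ c′} z → E x y → E x′ y′ → Touches (slot x y) z → Touches (slot x′ y′) z →
      (x , y , c) ≡ (x′ , y′ , c′) ⊎ Compatible E (x , y , c) (x′ , y′ , c′) ⊎ Compatible E (x′ , y′ , c′) (x , y , c) →
      slot x y ≢ slot x′ y′ → c ≢ c′
    clash z e e′ τ τ′ (inj₁ refl) ne = contradiction refl ne
    clash z e e′ τ τ′ (inj₂ comp) ne with touches⇒end (edge e) τ | touches⇒end (edge e′) τ′
    clash z e e′ τ τ′ (inj₂ (inj₁ (_ , dist))) ne | inj₁ refl | inj₁ refl = dist (inj₁ refl)
    clash z e e′ τ τ′ (inj₂ (inj₁ (_ , dist))) ne | inj₁ refl | inj₂ refl = dist (inj₂ (inj₁ refl))
    clash z e e′ τ τ′ (inj₂ (inj₁ (_ , dist))) ne | inj₂ refl | inj₁ refl = dist (inj₂ (inj₂ (inj₁ refl)))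
    clash z e e′ τ τ′ (inj₂ (inj₁ (_ , dist))) ne | inj₂ refl | inj₂ refl = dist (inj₂ (inj₂ (inj₂ refl)))
    clash z e e′ τ τ′ (inj₂ (inj₂ (_ , dist))) ne | inj₁ refl | inj₁ refl = dist (inj₁ refl) ∘ sym
    clash z e e′ τ τ′ (inj₂ (inj₂ (_ , dist))) ne | inj₁ refl | inj₂ refl = dist (inj₂ (inj₂ (inj₁ refl))) ∘ sym
    clash z e e′ τ τ′ (inj₂ (inj₂ (_ , dist))) ne | inj₂ refl | inj₁ refl = dist (inj₂ (inj₁ refl)) ∘ sym
    clash z e e′ τ τ′ (inj₂ (inj₂ (_ , dist))) ne | inj₂ refl | inj₂ refl = dist (inj₂ (inj₂ (inj₂ refl))) ∘ sym

    pre-apart : ∀ {z s s′} → Touches s z → Touches s′ z → s ≢ s′ → Apart (pre s) (pre s′)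
    pre-apart {z} τ τ′ ne k e e′
      with _ , _ , c , ∈φ , refl , k≡ ← pre-sound e | _ , _ , c′ , ∈φ′ , refl , k≡′ ← pre-sound e′ =
      let v , 1≤c , c≤k = All.lookup valid ∈φ
          v′ , 1≤c′ , c′≤k = All.lookup valid ∈φ′
      in clash z v v′ τ τ′ (allPairs-lookup compatible ∈φ ∈φ′) ne
           (toColour-injective 1≤c c≤k 1≤c′ c′≤k (trans (sym k≡) k≡′))

    open Precoloured D Δ≤D pre pre-apart

    light : Rooted.cost D pre t ≤ D
    light = ≤-trans (cost≤ D pre (Spans.uniq S) (λ e → ∈-map⁺ proj₁ (assoc-sound _≟ₛ_ (map key φ) e)))
      (≤-trans (≤-reflexive (trans (length-map proj₁ (map key φ)) (length-map key φ))) few)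

    open Extraction (Rooted.solve-root D pre 2≤D t tame-root light)

    f : V × Bool → V × Bool → ℕ
    f x y = suc (toℕ (colour (slot x y)))

    symmetric : ∀ x y → E x y → f x y ≡ f y x
    symmetric x y e = cong (suc ∘ toℕ ∘ colour) (slot-sym e (E-sym e))

    range : ∀ x y → E x y → 1 ≤ f x y × f x y ≤ suc D
    range x y e = s≤s z≤n , toℕ<n (colour (slot x y))

    proper : ∀ x y z → E x y → E x z → y ≢ z → f x y ≢ f x z
    proper x y z e e′ y≢z eq = colour-proper (touch (edge e)) (touch (edge e′)) slots≢ (toℕ-injective (suc-injective eq))
      where
      slots≢ : slot x y ≢ slot x z
      slots≢ same with edge-injective (edge e) (subst (Edge x z) (sym same) (edge e′))
      ... | inj₁ (_ , y≡z) = y≢z y≡z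
      ... | inj₂ (_ , refl) = edge-ends≢ (edge e) refl

    extends : Extends E f φ
    extends = All.tabulate λ {(x , y , c)} ∈φ →
      let e , 1≤c , c≤k = All.lookup valid ∈φ
      in trans (cong (suc ∘ toℕ) (colour-fits (touch (edge e))
            (assoc-complete _≟ₛ_ (keys-unique valid compatible) (∈-map⁺ key ∈φ))))
           (toColour-correct 1≤c c≤k)

  -- Maximum degree at most one.

  adjacent⇒1≤maxDegree : ∀ {u v} → Adj T u v → 1 ≤ maxDegree T
  adjacent⇒1≤maxDegree {v = v} uv = neighbours≤maxDegree T {ws = [ v ]} ([] ∷ []) (uv ∷ [])

  -- `a` goes to the copies of tree edges, `b` to the rungs.
  split : ℕ → ℕ → V × Bool → V × Bool → ℕ
  split a b (_ , i) (_ , j) with i Bool.≟ j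
  ... | yes _ = a
  ... | no _  = b

  split-rail : ∀ {a b} (u v : V) i → split a b (u , i) (v , i) ≡ a
  split-rail u v i with i Bool.≟ i
  ... | yes _  = refl
  ... | no i≢i = contradiction refl i≢i

  split-rung : ∀ {a b} (u v : V) {i j} → i ≢ j → split a b (u , i) (v , j) ≡ b
  split-rung u v {i} {j} i≢j with i Bool.≟ j
  ... | yes i≡j = contradiction i≡j i≢j
  ... | no _    = refl

  -- A vertex meets at most one tree edge and one rung. `a ≢ b` is asked only in the presence of a
  -- tree edge, so that the single colour available for degree zero is covered too.
  split-proper : ∀ {k} a b → maxDegree T ≤ 1 → (∀ {u v} → Adj T u v → a ≢ b) → 1 ≤ a × a ≤ k → 1 ≤ b × b ≤ k →
    ProperEdgeColouring E k (split a b)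
  split-proper {k} a b Δ≤1 a≢b a-ok b-ok = symmetric , range , proper
    where
    symmetric : ∀ x y → E x y → split a b x y ≡ split a b y x
    symmetric (u , i) (v , j) (inj₁ (_ , refl)) = trans (split-rail u v i) (sym (split-rail v u i))
    symmetric (u , i) (v , j) (inj₂ (_ , i≢j)) = trans (split-rung u v i≢j) (sym (split-rung v u (i≢j ∘ sym)))
    range : ∀ x y → E x y → 1 ≤ split a b x y × split a b x y ≤ k
    range (_ , i) (_ , j) _ with i Bool.≟ j
    ... | yes _ = a-ok
    ... | no _  = b-ok
    third : ∀ {i j k : Bool} → i ≢ j → i ≢ k → j ≡ k
    third i≢j i≢k = trans (Bool.¬-not (i≢j ∘ sym)) (sym (Bool.¬-not (i≢k ∘ sym)))
    proper : ∀ x y z → E x y → E x z → y ≢ z → split a b x y ≢ split a b x z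
    proper (u , i) (v , j) (w , k) (inj₁ (uv , refl)) (inj₁ (uw , refl)) y≢z _ =
      <-irrefl refl (≤-trans (neighbours≤maxDegree T (((λ v≡w → y≢z (cong (_, i) v≡w)) ∷ []) ∷ [] ∷ []) (uv ∷ uw ∷ [])) Δ≤1)
    proper (u , i) (v , j) (w , k) (inj₁ (uv , refl)) (inj₂ (_ , i≢k)) y≢z eq =
      a≢b uv (trans (sym (split-rail u v i)) (trans eq (split-rung u w i≢k)))
    proper (u , i) (v , j) (w , k) (inj₂ (_ , i≢j)) (inj₁ (uw , refl)) y≢z eq =
      a≢b uw (trans (sym (split-rail u w i)) (trans (sym eq) (split-rung u v i≢j)))
    proper (u , i) (v , j) (w , k) (inj₂ (refl , i≢j)) (inj₂ (refl , i≢k)) y≢z _ = y≢z (cong (u ,_) (third i≢j i≢k))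

  other-colour : ∀ {c} → 1 ≤ c → c ≤ 2 → ∃ λ d → c ≢ d × 1 ≤ d × d ≤ 2
  other-colour {1} _ _ = 2 , (λ ()) , s≤s z≤n , ≤-refl
  other-colour {2} _ _ = 1 , (λ ()) , ≤-refl , s≤s z≤n
  other-colour {suc (suc (suc _))} _ (s≤s (s≤s ()))

  extend-matching : ∀ {D} → maxDegree T ≡ D → D ≤ 1 → ∀ φ → IsPrecolouring E (suc D) φ → length φ ≡ D → Extension (suc D) φ
  extend-matching {zero} Δ≡0 _ [] _ _ = split 1 1
    , split-proper 1 1 (≤-trans (≤-reflexive Δ≡0) z≤n)
        (λ uv → contradiction (≤-trans (adjacent⇒1≤maxDegree uv) (≤-reflexive Δ≡0)) λ ())
        (≤-refl , ≤-refl) (≤-refl , ≤-refl)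
    , []
  extend-matching {suc zero} Δ≡1 _ (((u , i) , (v , j) , c) ∷ []) ((e , 1≤c , c≤2) ∷ [] , _) _
    with d , c≢d , d-ok ← other-colour 1≤c c≤2 | e
  ... | inj₁ (_ , refl) = split c d , split-proper c d (≤-reflexive Δ≡1) (λ _ → c≢d) (1≤c , c≤2) d-ok , split-rail u v i ∷ []
  ... | inj₂ (_ , i≢j) = split d c , split-proper d c (≤-reflexive Δ≡1) (λ _ → c≢d ∘ sym) d-ok (1≤c , c≤2) , split-rung u v i≢j ∷ []
  extend-matching {suc (suc _)} _ (s≤s ())

theorem2p3 : (n : ℕ) (T : SimpleGraph n) → IsTree T →
    (φ : List (PreEdge (□K₂Adj T))) →
    IsPrecolouring (□K₂Adj T) (suc (maxDegree T)) φ →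
    length φ ≡ maxDegree T →
    Σ (Fin n × Bool → Fin n × Bool → ℕ) λ f →
    ProperEdgeColouring (□K₂Adj T) (suc (maxDegree T)) f × Extends (□K₂Adj T) f φ
theorem2p3 (suc n) T (_ , connected , acyclic) φ φ-ok len with 2 ≤? maxDegree T
... | yes 2≤Δ =
  let t , S , all = Growth.spanning-tree T acyclic connected Fin.zero
  in extend-spanned T (maxDegree T) S all ≤-refl 2≤Δ φ φ-ok (≤-reflexive len)
... | no 2≰Δ = extend-matching T refl (≤-pred (≰⇒> 2≰Δ)) φ φ-ok len
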